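{- There is a basis $\{\mathbf{x}_A : A\in\Pi_n,\ n\ge 0\}$ of $\mathsf{NCSym}$ (indexed by all set partitions) such that (i) $\mathbf{x}_A\,\mathbf{x}_B=\mathbf{x}_{A|B}$ for all set partitions $A\in\Pi_n$, $B\in\Pi_m$, $n,m\ge 0$; (ii) $\Delta^{\odot}(\mathbf{x}_C)=\sum_{A\vee B=C}\mathbf{x}_A\otimes\mathbf{x}_B$ for all $C\in\Pi_n$, $n\ge 0$, where the sum is over all pairs $(A,B)\in\Pi_n\times\Pi_n$ with $A\vee B=C$.
   Context: $\Bbbk$ is a field of characteristic zero. $\Pi_n$ is the set of set partitions of $[n]=\{1,\dots,n\}$ ($\Pi_0$ consists only of the empty set partition), ordered by $A\le B$ iff every part of $A$ is contained in a part of $B$ (i.e. $A$ is finer than $B$). It is a lattice with meet $\wedge$ and join $\vee$, minimal element $\mathbf{0}_n=\{\{1\},\dots,\{n\}\}$ and maximal element $\mathbf{1}_n=\{[n]\}$. For $A\in\Pi_n$, $B\in\Pi_m$, the set partition $A|B\in\Pi_{n+m}$ consists of the parts of $A$ together with the parts of $B$ with every element shifted by $n$. $\mathsf{NCSym}=\bigoplus_{d\ge0}\mathsf{NCSym}_d$ is the $\Bbbk$-algebra of symmetric functions in noncommutative variables $x_1,x_2,\dots$. The space $\mathsf{NCSym}_d$ has basis $\{\mathbf{m}_A\}_{A\in\Pi_d}$, where $\mathbf{m}_A=\sum x_{i_1}x_{i_2}\cdots x_{i_d}$ is the formal sum over all sequences $(i_1,\dots,i_d)$ of positive integers such that $i_a=i_b$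 if and only if $a$ and $b$ are in the same part of $A$ (and $\mathbf{m}_\emptyset=1$). The product (induced by concatenation of words) is, for $A\in\Pi_d$, $B\in\Pi_m$, $$\mathbf{m}_A\mathbf{m}_B=\sum_{C\in\Pi_{d+m},\ C\wedge(\mathbf{1}_d|\mathbf{1}_m)=A|B}\mathbf{m}_C .$$ The internal comultiplication $\Delta^{\odot}:\mathsf{NCSym}_d\to\mathsf{NCSym}_d\otimes\mathsf{NCSym}_d$ is the linear map with $\Delta^{\odot}(\mathbf{m}_A)=\sum_{B\wedge C=A}\mathbf{m}_B\otimes\mathbf{m}_C$ (sum over pairs $(B,C)\in\Pi_d\times\Pi_d$). -}

module Defs where

open import Algebra.Bundles using (CommutativeRing)
import Algebra.Definitions.RawMonoid as RawMonoidDefinitions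
open import Algebra.Module.Bundles using (Module)
open import Algebra.Module.Structures using (IsLeftModule)
open import Algebra.Module.Structures.Biased using (IsModuleFromLeft)
import Algebra.Properties.Ring as RingProperties
open import Data.Bool using (if_then_else_)
import Data.Bool.Properties as Boolₚ
open import Data.Fin using (Fin; zero; suc; splitAt)
import Data.Fin as Fin
open import Data.Fin.Properties using (all?; any?; cast-trans)
open import Data.Fin.Subset using (Subset; Side; inside; outside; _∈_; _⊆_; _∩_; ⊤; ⊥)
open import Data.Fin.Subset.Properties using (_∈?_; _⊆?_; ∈⊤; ∉⊥; x∈p∩q⁺; x∈p∩q⁻)
open import Data.List
  using (List; []; _∷_; length; map; take; drop; upTo; foldr; filter; mapMaybe;
         cartesianProduct; cartesianProductWith)
import Data.List as List
import Data.List.Membership.Propositional as Membership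
open import Data.List.Properties
  using (length-map; length-++; take-map; drop-map; take++drop≡id)
open import Data.List.Relation.Unary.Unique.Propositional using (Unique)
import Data.Maybe as Maybe
open import Data.Nat using (ℕ; zero; suc; _<_; _⊔_; _≟_; _≤?_)
import Data.Nat as ℕ
import Data.Nat.Properties as ℕₚ
open import Data.Product using (Σ; ∃; ∃₂; _×_; _,_; proj₁; proj₂; uncurry)
open import Data.Sum using (_⊎_; inj₁; inj₂; [_,_]′)
open import Data.Vec using (Vec; []; _∷_; lookup; tabulate; _++_; toList)
import Data.Vec as Vec
import Data.Vec.Properties as Vecₚ
open import Function using (_∘_; const; _↔_; _⇔_; mk⇔; Inverse; Injection; Equivalence)
open import Function.Properties.Inverse using (↔⇒↣)
open import Level using () renaming (Level to Lvl; _⊔_ to _⊔ˡ_; suc to lsuc)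
open import Relation.Binary using (Decidable; DecidableEquality; IsEquivalence; Rel)
open import Relation.Binary.PropositionalEquality
  using (_≡_; _≢_; refl; sym; trans; cong; cong₂; subst)
open import Relation.Nullary using (¬_; Dec; yes; no; does; contradiction; recompute)
open import Relation.Nullary.Decidable
  using (_×-dec_; _→-dec_; map′; dec⇒maybe; dec-false; does-⇔)

private
  variable
    c ℓ m ℓm n′ ℓn : Lvl
    n k : ℕ

------------------------------------------------------------------------
-- Fields

record Field c ℓ : Set (lsuc (c ⊔ˡ ℓ)) where
  field
    commutativeRing : CommutativeRing c ℓ

  open CommutativeRing commutativeRing public

  field
    0≉1     : ¬ (0# ≈ 1#)
    inverse : ∀ x → ¬ (x ≈ 0#) → ∃ λ y → x * y ≈ 1#

CharacteristicZero : Field c ℓ → Set ℓ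
CharacteristicZero K = ∀ n → ¬ (suc n · 1# ≈ 0#)
  where
  open Field K hiding (refl; sym; trans)
  open RawMonoidDefinitions +-rawMonoid renaming (_×_ to _·_)

------------------------------------------------------------------------
-- Modules

module _ {R : CommutativeRing c ℓ} (M : Module R m ℓm) where
  open CommutativeRing R using (Carrier; _≈_; 0#)
  open Module M

  ∑ : ∀ {i} {I : Set i} → List I → (I → Carrierᴹ) → Carrierᴹ
  ∑ is f = foldr (λ i s → f i +ᴹ s) 0ᴹ is

  record IsBasis {I : Set} (x : I → Carrierᴹ) : Set (c ⊔ˡ ℓ ⊔ˡ m ⊔ˡ ℓm) where
    field
      independent : ∀ (is : List I) → Unique is → (a : I → Carrier) →
                    ∑ is (λ i → a i *ₗ x i) ≈ᴹ 0ᴹ →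
                    ∀ i → i Membership.∈ is → a i ≈ 0#
      spanning    : ∀ y → ∃₂ λ (is : List I) (a : I → Carrier) →
                    y ≈ᴹ ∑ is (λ i → a i *ₗ x i)

-- The tensor product is presented by generators and relations: module
-- expressions in the pure tensors, modulo the module axioms and bilinearity.
module TensorProduct {R : CommutativeRing c ℓ}
                     (M : Module R m ℓm) (N : Module R n′ ℓn) where
  open CommutativeRing R using (Carrier; _≈_; _+_; _*_; 0#; 1#)
  private
    module M = Module M
    module N = Module N

  infixr 8 -ᵀ_
  infixr 7 _*ᵀ_
  infix  7 _⊗_
  infixl 6 _+ᵀ_
  infix  4 _≈ᵀ_

  data Tensor : Set (c ⊔ˡ m ⊔ˡ n′) where
    _⊗_  : M.Carrierᴹ → N.Carrierᴹ → Tensor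
    0ᵀ   : Tensor
    _+ᵀ_ : Tensor → Tensor → Tensor
    -ᵀ_  : Tensor → Tensor
    _*ᵀ_ : Carrier → Tensor → Tensor

  data _≈ᵀ_ : Rel Tensor (c ⊔ˡ ℓ ⊔ˡ m ⊔ˡ ℓm ⊔ˡ n′ ⊔ˡ ℓn) where
    ≈-refl  : ∀ {s} → s ≈ᵀ s
    ≈-sym   : ∀ {s t} → s ≈ᵀ t → t ≈ᵀ s
    ≈-trans : ∀ {s t u} → s ≈ᵀ t → t ≈ᵀ u → s ≈ᵀ u

    ⊗-cong : ∀ {x x′ y y′} → x M.≈ᴹ x′ → y N.≈ᴹ y′ → x ⊗ y ≈ᵀ x′ ⊗ y′
    +-cong : ∀ {s s′ t t′} → s ≈ᵀ s′ → t ≈ᵀ t′ → s +ᵀ t ≈ᵀ s′ +ᵀ t′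
    -‿cong : ∀ {s s′} → s ≈ᵀ s′ → -ᵀ s ≈ᵀ -ᵀ s′
    *-cong : ∀ {a a′ s s′} → a ≈ a′ → s ≈ᵀ s′ → a *ᵀ s ≈ᵀ a′ *ᵀ s′

    +-assoc     : ∀ s t u → (s +ᵀ t) +ᵀ u ≈ᵀ s +ᵀ (t +ᵀ u)
    +-comm      : ∀ s t → s +ᵀ t ≈ᵀ t +ᵀ s
    +-identityˡ : ∀ s → 0ᵀ +ᵀ s ≈ᵀ s
    -‿inverseˡ  : ∀ s → (-ᵀ s) +ᵀ s ≈ᵀ 0ᵀ
    *-distribˡ  : ∀ a s t → a *ᵀ (s +ᵀ t) ≈ᵀ a *ᵀ s +ᵀ a *ᵀ t
    *-distribʳ  : ∀ s a b → (a + b) *ᵀ s ≈ᵀ a *ᵀ s +ᵀ b *ᵀ s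
    *-assoc     : ∀ a b s → (a * b) *ᵀ s ≈ᵀ a *ᵀ (b *ᵀ s)
    *-identityˡ : ∀ s → 1# *ᵀ s ≈ᵀ s
    *-zeroˡ     : ∀ s → 0# *ᵀ s ≈ᵀ 0ᵀ
    *-zeroʳ     : ∀ a → a *ᵀ 0ᵀ ≈ᵀ 0ᵀ

    ⊗-distribˡ : ∀ x y y′ → x ⊗ (y N.+ᴹ y′) ≈ᵀ x ⊗ y +ᵀ x ⊗ y′
    ⊗-distribʳ : ∀ x x′ y → (x M.+ᴹ x′) ⊗ y ≈ᵀ x ⊗ y +ᵀ x′ ⊗ y
    ⊗-scaleˡ   : ∀ a x y → (a M.*ₗ x) ⊗ y ≈ᵀ a *ᵀ (x ⊗ y)
    ⊗-scaleʳ   : ∀ a x y → x ⊗ (a N.*ₗ y) ≈ᵀ a *ᵀ (x ⊗ y)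

  private
    ≈ᵀ-isEquivalence : IsEquivalence _≈ᵀ_
    ≈ᵀ-isEquivalence = record { refl = ≈-refl ; sym = ≈-sym ; trans = ≈-trans }

    isLeftModule : IsLeftModule (CommutativeRing.ring R) _≈ᵀ_ _+ᵀ_ 0ᵀ -ᵀ_ _*ᵀ_
    isLeftModule = record
      { isLeftSemimodule = record
        { +ᴹ-isCommutativeMonoid = record
          { isMonoid = record
            { isSemigroup = record
              { isMagma = record
                { isEquivalence = ≈ᵀ-isEquivalence ; ∙-cong = +-cong }
              ; assoc = +-assoc
              }
            ; identity = +-identityˡ ,
                         λ s → ≈-trans (+-comm s 0ᵀ) (+-identityˡ s)
            }
          ; comm = +-comm
          }
        ; isPreleftSemimodule = record
          { *ₗ-cong = *-cong
          ; *ₗ-zeroˡ = *-zeroˡ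
          ; *ₗ-distribʳ = *-distribʳ
          ; *ₗ-identityˡ = *-identityˡ
          ; *ₗ-assoc = *-assoc
          ; *ₗ-zeroʳ = *-zeroʳ
          ; *ₗ-distribˡ = *-distribˡ
          }
        }
      ; -ᴹ‿cong = -‿cong
      ; -ᴹ‿inverse = -‿inverseˡ ,
                     λ s → ≈-trans (+-comm s (-ᵀ s)) (-‿inverseˡ s)
      }

  tensorModule : Module R (c ⊔ˡ m ⊔ˡ n′) (c ⊔ˡ ℓ ⊔ˡ m ⊔ˡ ℓm ⊔ˡ n′ ⊔ˡ ℓn)
  tensorModule = record
    { isModule = IsModuleFromLeft.isModule
        (record { isLeftModule = isLeftModule }) }

------------------------------------------------------------------------
-- Set partitions

record IsSetPartition (parts : Vec (Subset n) n) : Set where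
  field
    covers   : ∀ i → i ∈ lookup parts i
    coherent : ∀ i j → j ∈ lookup parts i → lookup parts j ≡ lookup parts i

-- A set partition of Fin n, stored as the table sending each element to the
-- part containing it; the parts are the entries of the table.  Since the
-- proof is irrelevant, _≡_ is equality of set partitions.
record SetPartition (n : ℕ) : Set where
  constructor mkSetPartition
  field
    parts           : Vec (Subset n) n
    .isSetPartition : IsSetPartition parts

open SetPartition public using (parts)

part : SetPartition n → Fin n → Subset n
part A = lookup (parts A)

infix 4 _≟ˢ_ _≟ᵖ_ _≤ᵖ_ _≤ᵖ?_

_≟ˢ_ : DecidableEquality (Subset n)
_≟ˢ_ = Vecₚ.≡-dec Boolₚ._≟_

_≟ᵖ_ : DecidableEquality (SetPartition n)
mkSetPartition p _ ≟ᵖ mkSetPartition q _ =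
  map′ (λ { refl → refl }) (cong parts) (Vecₚ.≡-dec _≟ˢ_ p q)

isSetPartition? : (p : Vec (Subset n) n) → Dec (IsSetPartition p)
isSetPartition? p =
  map′ (λ (c , d) → record { covers = c ; coherent = d })
       (λ P → IsSetPartition.covers P , IsSetPartition.coherent P)
       (all? (λ i → i ∈? lookup p i) ×-dec
        all? (λ i → all? (λ j →
          (j ∈? lookup p i) →-dec (lookup p j ≟ˢ lookup p i))))

part-covers : (A : SetPartition n) → ∀ i → i ∈ part A i
part-covers (mkSetPartition p P) =
  IsSetPartition.covers (recompute (isSetPartition? p) P)

part-coherent : (A : SetPartition n) →
                ∀ i j → j ∈ part A i → part A j ≡ part A i
part-coherent (mkSetPartition p P) =
  IsSetPartition.coherent (recompute (isSetPartition? p) P)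

fromParts : (p : Fin n → Subset n) → (∀ i → i ∈ p i) →
            (∀ i j → j ∈ p i → p j ≡ p i) → SetPartition n
fromParts p covers coherent = mkSetPartition (tabulate p) (record
  { covers   = λ i → subst (i ∈_) (sym (lookup-p i)) (covers i)
  ; coherent = λ i j j∈pᵢ → trans (lookup-p j)
      (trans (coherent i j (subst (j ∈_) (lookup-p i) j∈pᵢ)) (sym (lookup-p i)))
  })
  where
  lookup-p : ∀ i → lookup (tabulate p) i ≡ p i
  lookup-p = Vecₚ.lookup∘tabulate p

allVecs : ∀ {a} {A : Set a} → List A → ∀ n → List (Vec A n)
allVecs xs zero    = [] ∷ []
allVecs xs (suc n) = cartesianProductWith _∷_ xs (allVecs xs n)

allSetPartitions : ∀ n → List (SetPartition n)
allSetPartitions n = mapMaybe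
  (λ p → Maybe.map (λ P → mkSetPartition p P) (dec⇒maybe (isSetPartition? p)))
  (allVecs (allVecs (inside ∷ outside ∷ []) n) n)

_≤ᵖ_ : SetPartition n → SetPartition n → Set
A ≤ᵖ B = ∀ i → ∃ λ j → part A i ⊆ part B j

_≤ᵖ?_ : Decidable (_≤ᵖ_ {n})
A ≤ᵖ? B = all? (λ i → any? (λ j → part A i ⊆? part B j))

infixr 7 _∧_
infixr 6 _∨_
infixr 5 _∣_

-- The parts of A ∧ B are the nonempty intersections of a part of A with a
-- part of B.
_∧_ : SetPartition n → SetPartition n → SetPartition n
A ∧ B = fromParts (λ i → part A i ∩ part B i)
  (λ i → x∈p∩q⁺ (part-covers A i , part-covers B i))
  (λ i j j∈ → let (j∈A , j∈B) = x∈p∩q⁻ (part A i) (part B i) j∈ in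
    cong₂ _∩_ (part-coherent A i j j∈A) (part-coherent B i j j∈B))

𝟏 : SetPartition n
𝟏 = fromParts (const ⊤) (λ _ → ∈⊤) (λ _ _ _ → refl)

-- The least upper bound, as the meet of all common upper bounds.
_∨_ : SetPartition n → SetPartition n → SetPartition n
_∨_ {n} A B = foldr _∧_ 𝟏
  (filter (λ D → (A ≤ᵖ? D) ×-dec (B ≤ᵖ? D)) (allSetPartitions n))

private
  ∈-lookup : ∀ {i} {p : Subset n} → i ∈ p → lookup p i ≡ inside
  ∈-lookup = Vecₚ.[]=⇒lookup

  lookup-∈ : ∀ i (p : Subset n) → lookup p i ≡ inside → i ∈ p
  lookup-∈ = Vecₚ.lookup⇒[]=

  lookup-⊥ : (i : Fin n) → ¬ (lookup ⊥ i ≡ inside)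
  lookup-⊥ i eq = ∉⊥ (lookup-∈ i ⊥ eq)

-- Under splitAt n, inj₁ i is the element i of the first block of n elements
-- and inj₂ j is the element j shifted by n.
_∣_ : SetPartition n → SetPartition k → SetPartition (n ℕ.+ k)
_∣_ {n} {k} A B = fromParts (p ∘ splitAt n)
  (λ i → lookup-∈ i (p (splitAt n i))
    (trans (lookup-p (splitAt n i) i) (covers (splitAt n i))))
  (λ i j j∈ → coherent (splitAt n i) (splitAt n j)
    (trans (sym (lookup-p (splitAt n i) j)) (∈-lookup j∈)))
  where
  p : Fin n ⊎ Fin k → Subset (n ℕ.+ k)
  p = [ (λ i → part A i ++ ⊥) , (λ j → ⊥ ++ part B j) ]′

  look : Fin n ⊎ Fin k → Fin n ⊎ Fin k → Side
  look (inj₁ i) = [ lookup (part A i) , lookup ⊥ ]′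
  look (inj₂ j) = [ lookup ⊥ , lookup (part B j) ]′

  lookup-p : ∀ s j → lookup (p s) j ≡ look s (splitAt n j)
  lookup-p (inj₁ i) j = Vecₚ.lookup-splitAt n (part A i) ⊥ j
  lookup-p (inj₂ i) j = Vecₚ.lookup-splitAt n ⊥ (part B i) j

  covers : ∀ s → look s s ≡ inside
  covers (inj₁ i) = ∈-lookup (part-covers A i)
  covers (inj₂ j) = ∈-lookup (part-covers B j)

  coherent : ∀ s t → look s t ≡ inside → p t ≡ p s
  coherent (inj₁ i) (inj₁ j) eq =
    cong (_++ ⊥) (part-coherent A i j (lookup-∈ j (part A i) eq))
  coherent (inj₁ i) (inj₂ j) eq = contradiction eq (lookup-⊥ j)
  coherent (inj₂ i) (inj₁ j) eq = contradiction eq (lookup-⊥ j)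
  coherent (inj₂ i) (inj₂ j) eq =
    cong (⊥ ++_) (part-coherent B i j (lookup-∈ j (part B i) eq))

meetPairs joinPairs : SetPartition n → List (SetPartition n × SetPartition n)
meetPairs {n} A = filter (λ (B , C) → B ∧ C ≟ᵖ A)
  (cartesianProduct (allSetPartitions n) (allSetPartitions n))
joinPairs {n} C = filter (λ (A , B) → A ∨ B ≟ᵖ C)
  (cartesianProduct (allSetPartitions n) (allSetPartitions n))

------------------------------------------------------------------------
-- Words

-- The word x_{i₁} ⋯ x_{i_d}, as its list of indices; variables are indexed
-- from 0.
Word : Set
Word = List ℕ

-- (_ , A) for a set partition A of [n] for some n ≥ 0.
AnySetPartition : Set
AnySetPartition = ∃ SetPartition

letter : (w : Word) → .(n ≡ length w) → Fin n → ℕ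
letter w eq a = List.lookup w (Fin.cast eq a)

-- x_w is one of the monomials of 𝐦_A.
HasKernel : SetPartition n → Word → Set
HasKernel {n} A w = Σ (n ≡ length w) λ eq →
  ∀ a b → (letter w eq a ≡ letter w eq b) ⇔ (b ∈ part A a)

hasKernel? : (A : SetPartition n) → ∀ w → Dec (HasKernel A w)
hasKernel? {n} A w with n ≟ length w
... | no n≢   = no (n≢ ∘ proj₁)
... | yes eq = map′ (eq ,_) proj₂
  (all? (λ a → all? (λ b →
    map′ (uncurry mk⇔) (λ e → Equivalence.to e , Equivalence.from e)
      (((letter w eq a ≟ letter w eq b) →-dec (b ∈? part A a)) ×-dec
       ((b ∈? part A a) →-dec (letter w eq a ≟ letter w eq b))))))

private
  lookup-map : ∀ (f : ℕ → ℕ) w i →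
    List.lookup (map f w) i ≡ f (List.lookup w (Fin.cast (length-map f w) i))
  lookup-map f (x ∷ w) zero    = refl
  lookup-map f (x ∷ w) (suc i) = lookup-map f w i

leastElement : Subset n → ℕ
leastElement []            = 0
leastElement (inside  ∷ p) = 0
leastElement (outside ∷ p) = suc (leastElement p)

-- A word with kernel A: each position carries the least element of its part.
canonicalWord : SetPartition n → Word
canonicalWord A = toList (Vec.map leastElement (parts A))

------------------------------------------------------------------------
-- Symmetric functions in noncommuting variables

module NCSymmetric {c ℓ} (K : Field c ℓ) where
  open Field K hiding (refl; sym; trans)
  private module K = Field K

  infix  4 _≋_
  infixl 6 _⊕_
  infixl 7 _⊙_
  infixr 7 _∙_

  -- A symmetric formal power series of bounded degree, by its coefficients.
  record NCSym : Set (c ⊔ˡ ℓ) where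
    field
      coeff     : Word → Carrier
      symmetric : ∀ (σ : ℕ ↔ ℕ) w → coeff (map (Inverse.to σ) w) ≈ coeff w
      degree    : ℕ
      bounded   : ∀ w → degree < length w → coeff w ≈ 0#

  open NCSym public

  _≋_ : Rel NCSym ℓ
  f ≋ g = ∀ w → coeff f w ≈ coeff g w

  IsHomogeneous : ℕ → NCSym → Set ℓ
  IsHomogeneous d f = ∀ w → length w ≢ d → coeff f w ≈ 0#

  private
    0ᴺ : NCSym
    0ᴺ = record
      { coeff = λ _ → 0# ; symmetric = λ _ _ → K.refl
      ; degree = 0 ; bounded = λ _ _ → K.refl }

    _⊕_ : NCSym → NCSym → NCSym
    f ⊕ g = record
      { coeff = λ w → coeff f w + coeff g w
      ; symmetric = λ σ w → +-cong (symmetric f σ w) (symmetric g σ w)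
      ; degree = degree f ⊔ degree g
      ; bounded = λ w d<w → K.trans
          (+-cong (bounded f w (ℕₚ.≤-<-trans (ℕₚ.m≤m⊔n _ _) d<w))
                  (bounded g w (ℕₚ.≤-<-trans (ℕₚ.m≤n⊔m (degree f) _) d<w)))
          (+-identityˡ 0#)
      }

    _∙_ : Carrier → NCSym → NCSym
    a ∙ f = record
      { coeff = λ w → a * coeff f w
      ; symmetric = λ σ w → *-congˡ (symmetric f σ w)
      ; degree = degree f
      ; bounded = λ w d<w → K.trans (*-congˡ (bounded f w d<w)) (zeroʳ a)
      }

    ⊖_ : NCSym → NCSym
    ⊖ f = record
      { coeff = λ w → - coeff f w
      ; symmetric = λ σ w → -‿cong (symmetric f σ w)
      ; degree = degree f
      ; bounded = λ w d<w → K.trans (-‿cong (bounded f w d<w)) -0#≈0#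
      }
      where open RingProperties ring using (-0#≈0#)

    isLeftModule : IsLeftModule ring _≋_ _⊕_ 0ᴺ ⊖_ _∙_
    isLeftModule = record
      { isLeftSemimodule = record
        { +ᴹ-isCommutativeMonoid = record
          { isMonoid = record
            { isSemigroup = record
              { isMagma = record
                { isEquivalence = record
                  { refl  = λ _ → K.refl
                  ; sym   = λ p w → K.sym (p w)
                  ; trans = λ p q w → K.trans (p w) (q w)
                  }
                ; ∙-cong = λ p q w → +-cong (p w) (q w)
                }
              ; assoc = λ f g h w → +-assoc _ _ _
              }
            ; identity = (λ f w → +-identityˡ _) , (λ f w → +-identityʳ _)
            }
          ; comm = λ f g w → +-comm _ _
          }
        ; isPreleftSemimodule = record
          { *ₗ-cong = λ p q w → *-cong p (q w)
          ; *ₗ-zeroˡ = λ f w → zeroˡ _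
          ; *ₗ-distribʳ = λ f a b w → distribʳ _ _ _
          ; *ₗ-identityˡ = λ f w → *-identityˡ _
          ; *ₗ-assoc = λ a b f w → *-assoc _ _ _
          ; *ₗ-zeroʳ = λ a w → zeroʳ _
          ; *ₗ-distribˡ = λ a f g w → distribˡ _ _ _
          }
        }
      ; -ᴹ‿cong = λ p w → -‿cong (p w)
      ; -ᴹ‿inverse = (λ f w → -‿inverseˡ _) , (λ f w → -‿inverseʳ _)
      }

  ncsym : Module commutativeRing (c ⊔ˡ ℓ) ℓ
  ncsym = record
    { isModule = IsModuleFromLeft.isModule
        (record { isLeftModule = isLeftModule }) }

  ∑ᴷ : ∀ {I : Set} → List I → (I → Carrier) → Carrier
  ∑ᴷ is a = foldr (λ i s → a i + s) 0# is

  private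
    ∑ᴷ-cong : ∀ {I : Set} (is : List I) {a b : I → Carrier} →
              (∀ i → a i ≈ b i) → ∑ᴷ is a ≈ ∑ᴷ is b
    ∑ᴷ-cong []       a≈b = K.refl
    ∑ᴷ-cong (i ∷ is) a≈b = +-cong (a≈b i) (∑ᴷ-cong is a≈b)

    ∑ᴷ-zero : ∀ {I : Set} (is : List I) {a : I → Carrier} →
              (∀ i → a i ≈ 0#) → ∑ᴷ is a ≈ 0#
    ∑ᴷ-zero []       a≈0 = K.refl
    ∑ᴷ-zero (i ∷ is) a≈0 =
      K.trans (+-cong (a≈0 i) (∑ᴷ-zero is a≈0)) (+-identityˡ 0#)

  -- Product of power series: sum over all factorisations of w as a
  -- concatenation of two words.
  _⊙_ : NCSym → NCSym → NCSym
  f ⊙ g = record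
    { coeff = λ w → ∑ᴷ (upTo (suc (length w))) (term w)
    ; symmetric = λ σ w → K.trans
        (reflexive (cong (λ l → ∑ᴷ (upTo (suc l)) (term (map (Inverse.to σ) w)))
          (length-map (Inverse.to σ) w)))
        (∑ᴷ-cong (upTo (suc (length w))) (λ i → *-cong
          (K.trans (reflexive (cong (coeff f) (take-map i w)))
                   (symmetric f σ (take i w)))
          (K.trans (reflexive (cong (coeff g) (drop-map i w)))
                   (symmetric g σ (drop i w)))))
    ; degree = degree f ℕ.+ degree g
    ; bounded = λ w d<w → ∑ᴷ-zero (upTo (suc (length w))) (vanish w d<w)
    }
    where
    term : Word → ℕ → Carrier
    term w i = coeff f (take i w) * coeff g (drop i w)

    vanish : ∀ w → degree f ℕ.+ degree g < length w → ∀ i → term w i ≈ 0#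
    vanish w d<w i with length (take i w) ≤? degree f
    ... | no  ≰f = K.trans (*-congʳ (bounded f _ (ℕₚ.≰⇒> ≰f))) (zeroˡ _)
    ... | yes ≤f with length (drop i w) ≤? degree g
    ...   | no  ≰g = K.trans (*-congˡ (bounded g _ (ℕₚ.≰⇒> ≰g))) (zeroʳ _)
    ...   | yes ≤g = contradiction
      (ℕₚ.<-≤-trans d<w (ℕₚ.≤-trans (ℕₚ.≤-reflexive length-w) (ℕₚ.+-mono-≤ ≤f ≤g)))
      (ℕₚ.<-irrefl refl)
      where
      length-w : length w ≡ length (take i w) ℕ.+ length (drop i w)
      length-w = trans (cong length (sym (take++drop≡id i w)))
                       (length-++ (take i w))

  𝐦 : SetPartition n → NCSym
  𝐦 {n} A = record
    { coeff = λ w → if does (hasKernel? A w) then 1# else 0#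
    ; symmetric = λ σ w → reflexive (cong (λ b → if b then 1# else 0#)
        (does-⇔ (mk⇔ (unrename σ w) (rename σ w))
          (hasKernel? A (map (Inverse.to σ) w)) (hasKernel? A w)))
    ; degree = n
    ; bounded = λ w n<w → reflexive (cong (λ b → if b then 1# else 0#)
        (dec-false (hasKernel? A w) (λ (n≡w , _) → ℕₚ.<-irrefl n≡w n<w)))
    }
    where
    letter-map : ∀ (f : ℕ → ℕ) w (eq : n ≡ length w) (eq′ : n ≡ length (map f w)) →
                 ∀ a → letter (map f w) eq′ a ≡ f (letter w eq a)
    letter-map f w eq eq′ a =
      trans (lookup-map f w (Fin.cast eq′ a))
            (cong (f ∘ List.lookup w)
              (cast-trans eq′ (length-map f w) a))

    rename : ∀ σ w → HasKernel A w → HasKernel A (map (Inverse.to σ) w)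
    rename σ w (eq , h) = eq′ , λ a b → mk⇔
      (λ e → Equivalence.to (h a b) (Injection.injective (↔⇒↣ σ)
        (trans (sym (lm a)) (trans e (lm b)))))
      (λ b∈ → trans (lm a) (trans (cong (Inverse.to σ)
        (Equivalence.from (h a b) b∈)) (sym (lm b))))
      where
      eq′ : n ≡ length (map (Inverse.to σ) w)
      eq′ = trans eq (sym (length-map (Inverse.to σ) w))
      lm = letter-map (Inverse.to σ) w eq eq′

    unrename : ∀ σ w → HasKernel A (map (Inverse.to σ) w) → HasKernel A w
    unrename σ w (eq′ , h) = eq , λ a b → mk⇔
      (λ e → Equivalence.to (h a b)
        (trans (lm a) (trans (cong (Inverse.to σ) e) (sym (lm b)))))
      (λ b∈ → Injection.injective (↔⇒↣ σ)
        (trans (sym (lm a)) (trans (Equivalence.from (h a b) b∈) (lm b))))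
      where
      eq : n ≡ length w
      eq = trans eq′ (length-map (Inverse.to σ) w)
      lm = letter-map (Inverse.to σ) w eq eq′

  open TensorProduct ncsym ncsym public

  -- The linear map sending 𝐦_A to the sum of 𝐦_B ⊗ 𝐦_C over B ∧ C = A.  The
  -- coordinate of f on 𝐦_A is the coefficient in f of any word with kernel A.
  Δ : NCSym → Tensor
  Δ f = ∑ tensorModule (upTo (suc (degree f))) λ d →
        ∑ tensorModule (allSetPartitions d) λ A →
          coeff f (canonicalWord A) *ᵀ
            ∑ tensorModule (meetPairs A) λ (B , C) → 𝐦 B ⊗ 𝐦 C

-- Let 𝐩_A = Σ_{B ≥ A} 𝐦_B, the sum of the words whose letters agree within each
-- part of A.  Then 𝐩_A 𝐩_B = 𝐩_{A|B}, and Δ 𝐩_A = 𝐩_A ⊗ 𝐩_A because A ≤ B ∧ C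
-- iff A ≤ B and A ≤ C.  The basis 𝐱 is determined by 𝐩_A = Σ_{B ≤ A} 𝐱_B, and
-- both formulas are checked after summing over lower sets, which loses nothing
-- by Möbius inversion.  For products this works because the partitions below
-- A|B are the A′|B′ with A′ ≤ A and B′ ≤ B; for the coproduct because
-- A ∨ B ≤ C iff A ≤ C and B ≤ C.  The basis property follows from Abel summation:
-- if b(A) = Σ_{E ≥ A} f(E) then Σ_A b(A) 𝐱_A = Σ_E f(E) 𝐩_E, and the 𝐩_E are
-- unitriangular in the 𝐦_C.

{-# OPTIONS --safe #-}
module Submission where

open import Algebra.Bundles using (CommutativeMonoid; AbelianGroup)
open import Algebra.Module.Bundles using (Module)
import Algebra.Properties.AbelianGroup as AbelianGroupProperties
import Algebra.Properties.CommutativeSemigroup as CommutativeSemigroupProperties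
open import Data.Bool using (true; false; if_then_else_)
open import Data.Fin using (Fin; zero; suc; toℕ; splitAt; _↑ˡ_; _↑ʳ_)
open import Data.Fin.Induction using (spo-wellFounded)
open import Data.Fin.Properties
  using (any?; toℕ-injective; splitAt-↑ˡ; splitAt-↑ʳ; splitAt⁻¹-↑ˡ; splitAt⁻¹-↑ʳ)
open import Data.Fin.Subset using (Subset; inside; outside; _∈_; _∩_; ⊥)
open import Data.Fin.Subset.Properties using (⊆-antisym; ∈⊤; ∉⊥; x∈p∩q⁺; x∈p∩q⁻)
open import Data.List
  using (List; []; _∷_; map; mapMaybe; foldr; filter; concatMap; cartesianProduct;
         length; take; drop; upTo)
import Data.List as List
open import Data.List.Membership.Propositional using () renaming (_∈_ to _∈ˡ_)
open import Data.List.Membership.Propositional.Properties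
  using (∈-cartesianProductWith⁺; ∈-cartesianProduct⁺; ∈-filter⁺; ∈-filter⁻; ∈-upTo⁺; ∈-upTo⁻)
open import Data.List.Properties using (length-++; length-take; take++drop≡id)
import Data.List.Relation.Unary.All as All
open import Data.List.Relation.Unary.AllPairs using ([]; _∷_)
open import Data.List.Relation.Unary.All using ([]; _∷_)
open import Data.List.Relation.Unary.Any using (here; there; index)
open import Data.List.Relation.Unary.Any.Properties using (lookup-index)
open import Data.List.Relation.Unary.Unique.Propositional using (Unique)
open import Data.List.Relation.Unary.Unique.Propositional.Properties
  using (upTo⁺; cartesianProduct⁺; cartesianProductWith⁺)
open import Data.Maybe using (Maybe; just; nothing)
import Data.Maybe as Maybe
open import Data.Nat using (ℕ; zero; suc)
import Data.Nat as ℕ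
import Data.Nat.Properties as ℕₚ
open import Data.Product using (∃; ∃₂; _×_; _,_; proj₁; proj₂)
open import Data.Product.Properties using () renaming (≡-dec to Σ-≡-dec)
open import Data.Sum using (_⊎_; inj₁; inj₂; [_,_]′)
open import Data.Vec
  using (Vec; []; _∷_; here; there; lookup; tabulate; _++_; toList; fromList)
import Data.Vec as Vec
open import Data.Vec.Properties
  using (lookup∘tabulate; tabulate∘lookup; tabulate-cong; []=⇒lookup; lookup⇒[]=;
         ∷-injective; lookup-++ˡ; lookup-++ʳ; lookup-map; length-toList; toList∘fromList)
open import Defs
open import Function using (_∘_; _⇔_; _↔_; mk⇔; mk↔ₛ′; flip; Equivalence; Inverse)
open import Function.Construct.Composition using (_↔-∘_)
open import Function.Construct.Identity using (↔-id)
open import Induction.WellFounded using (Acc; acc; WellFounded)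
open import Level using (Level; 0ℓ)
open import Relation.Binary using (Decidable; DecidableEquality; IsPartialOrder; Rel)
import Relation.Binary.Construct.Flip.EqAndOrd as Flip
import Relation.Binary.Construct.NonStrictToStrict as ToStrict
import Relation.Binary.Construct.On as On
open import Relation.Binary.PropositionalEquality
  using (_≡_; _≢_; refl; sym; trans; cong; cong₂; subst; subst₂; isEquivalence)
import Relation.Binary.Reasoning.Setoid as SetoidReasoning
open import Relation.Nullary using (¬_; Dec; yes; no; does; contradiction)
open import Relation.Nullary.Decidable
  using (_×-dec_; ¬?; dec-true; dec-false; dec⇒maybe; does-⇔)

-- Equality in the tensor product is generated by relations, so comparing two tensors coefficient by
-- coefficient would first need a basis of it. Möbius inversion is therefore set up for functions
-- with values in an arbitrary abelian group: in `K` it produces the coefficients of `𝐱` and their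
-- multiplicativity, in the tensor module it proves the coproduct formula. No formula for the Möbius
-- function enters. An inverse exists by recursion along the order and is unique by induction along
-- it. On the side of `NCSym` everything is evaluated on words. A coefficient depends only on the
-- kernel of the word, the partition of its positions by equal letters, so identities between the
-- `𝐱` become identities of one matrix `ξ` indexed by pairs of partitions.

private
  variable
    n m : ℕ

-- Finite sums in a commutative monoid.

module FiniteSums {c ℓ} (M : CommutativeMonoid c ℓ) where
  open CommutativeMonoid M renaming (refl to ≈-refl; sym to ≈-sym; trans to ≈-trans)
  open CommutativeSemigroupProperties commutativeSemigroup using (interchange)
  open SetoidReasoning setoid

  private
    variable
      i j p q : Level
      I : Set i
      J : Set j
      P : Set p
      Q : Set q

  sum : List I → (I → Carrier) → Carrier
  sum is f = foldr (λ i s → f i ∙ s) ε is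

  -- Sums over subsets are written as sums over a full enumeration with this indicator, so that
  -- exchanging two sums never disturbs a list of indices.
  when : Dec P → Carrier → Carrier
  when P? x = if does P? then x else ε

  when-true : (P? : Dec P) {x : Carrier} → P → when P? x ≈ x
  when-true P? {x} p = reflexive (cong (λ b → if b then x else ε) (dec-true P? p))

  when-false : (P? : Dec P) {x : Carrier} → ¬ P → when P? x ≈ ε
  when-false P? {x} ¬p = reflexive (cong (λ b → if b then x else ε) (dec-false P? ¬p))

  when-cong : (P? : Dec P) {x y : Carrier} → (P → x ≈ y) → when P? x ≈ when P? y
  when-cong (yes p) x≈y = x≈y p
  when-cong (no ¬p) x≈y = ≈-refl

  when-⇔ : (P? : Dec P) (Q? : Dec Q) {x : Carrier} → P ⇔ Q → when P? x ≈ when Q? x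
  when-⇔ P? Q? {x} P⇔Q = reflexive (cong (λ b → if b then x else ε) (does-⇔ P⇔Q P? Q?))

  when-× : (P? : Dec P) (Q? : Dec Q) {x : Carrier} →
           when P? (when Q? x) ≈ when (P? ×-dec Q?) x
  when-× (yes _) (yes _) = ≈-refl
  when-× (yes _) (no  _) = ≈-refl
  when-× (no  _) _       = ≈-refl

  when-swap : (P? : Dec P) (Q? : Dec Q) {x : Carrier} →
              when P? (when Q? x) ≈ when Q? (when P? x)
  when-swap (yes _) (yes _) = ≈-refl
  when-swap (yes _) (no  _) = ≈-refl
  when-swap (no  _) (yes _) = ≈-refl
  when-swap (no  _) (no  _) = ≈-refl

  sum-cong-∈ : (is : List I) {f g : I → Carrier} →
               (∀ i → i ∈ˡ is → f i ≈ g i) → sum is f ≈ sum is g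
  sum-cong-∈ []       f≈g = ≈-refl
  sum-cong-∈ (i ∷ is) f≈g =
    ∙-cong (f≈g i (here refl)) (sum-cong-∈ is (λ j → f≈g j ∘ there))

  sum-cong : (is : List I) {f g : I → Carrier} →
             (∀ i → f i ≈ g i) → sum is f ≈ sum is g
  sum-cong is f≈g = sum-cong-∈ is (λ i _ → f≈g i)

  sum-ε : (is : List I) → sum is (λ _ → ε) ≈ ε
  sum-ε []       = ≈-refl
  sum-ε (i ∷ is) = ≈-trans (identityˡ _) (sum-ε is)

  sum-zero : (is : List I) {f : I → Carrier} → (∀ i → f i ≈ ε) → sum is f ≈ ε
  sum-zero is f≈ε = ≈-trans (sum-cong is f≈ε) (sum-ε is)

  sum-∙ : (is : List I) (f g : I → Carrier) →
          sum is (λ i → f i ∙ g i) ≈ sum is f ∙ sum is g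
  sum-∙ []       f g = ≈-sym (identityˡ ε)
  sum-∙ (i ∷ is) f g = ≈-trans (∙-congˡ (sum-∙ is f g)) (interchange _ _ _ _)

  sum-swap : (is : List I) (js : List J) (f : I → J → Carrier) →
             sum is (λ i → sum js (f i)) ≈ sum js (λ j → sum is (λ i → f i j))
  sum-swap []       js f = ≈-sym (sum-ε js)
  sum-swap (i ∷ is) js f = ≈-trans (∙-congˡ (sum-swap is js f)) (≈-sym (sum-∙ js _ _))

  sum-++ : (is js : List I) (f : I → Carrier) →
           sum (is List.++ js) f ≈ sum is f ∙ sum js f
  sum-++ []       js f = ≈-sym (identityˡ _)
  sum-++ (i ∷ is) js f = ≈-trans (∙-congˡ (sum-++ is js f)) (≈-sym (assoc _ _ _))

  sum-map : (h : J → I) (js : List J) (f : I → Carrier) →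
            sum (map h js) f ≈ sum js (f ∘ h)
  sum-map h []       f = ≈-refl
  sum-map h (j ∷ js) f = ∙-congˡ (sum-map h js f)

  sum-concatMap : (h : J → List I) (js : List J) (f : I → Carrier) →
                  sum (concatMap h js) f ≈ sum js (λ j → sum (h j) f)
  sum-concatMap h []       f = ≈-refl
  sum-concatMap h (j ∷ js) f =
    ≈-trans (sum-++ (h j) (concatMap h js) f) (∙-congˡ (sum-concatMap h js f))

  sum-cartesianProduct : (is : List I) (js : List J) (f : I × J → Carrier) →
    sum (cartesianProduct is js) f ≈ sum is (λ i → sum js (λ j → f (i , j)))
  sum-cartesianProduct []       js f = ≈-refl
  sum-cartesianProduct (i ∷ is) js f =
    ≈-trans (sum-++ (map (i ,_) js) (cartesianProduct is js) f)
            (∙-cong (sum-map (i ,_) js f) (sum-cartesianProduct is js f))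

  sum-filter : {P : I → Set p} (P? : ∀ i → Dec (P i)) (is : List I) (f : I → Carrier) →
               sum (filter P? is) f ≈ sum is (λ i → when (P? i) (f i))
  sum-filter P? []       f = ≈-refl
  sum-filter P? (i ∷ is) f with does (P? i)
  ... | true  = ∙-congˡ (sum-filter P? is f)
  ... | false = ≈-trans (sum-filter P? is f) (≈-sym (identityˡ _))

  sum-when : (P? : Dec P) (is : List I) (f : I → Carrier) →
             when P? (sum is f) ≈ sum is (λ i → when P? (f i))
  sum-when (yes _) is f = ≈-refl
  sum-when (no  _) is f = ≈-sym (sum-ε is)

  sum-single : {is : List I} {i : I} (f : I → Carrier) → Unique is → i ∈ˡ is →
               (∀ j → j ∈ˡ is → j ≢ i → f j ≈ ε) → sum is f ≈ f i
  sum-single {is = _ ∷ is} f (i∉is ∷ _) (here refl) f≈ε = ≈-trans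
    (∙-congˡ (≈-trans
      (sum-cong-∈ is (λ j j∈is → f≈ε j (there j∈is) (All.lookup i∉is j∈is ∘ sym)))
      (sum-ε is)))
    (identityʳ _)
  sum-single f (j∉is ∷ u) (there i∈is) f≈ε = ≈-trans
    (∙-cong (f≈ε _ (here refl) (All.lookup j∉is i∈is))
            (sum-single f u i∈is (λ k k∈is → f≈ε k (there k∈is))))
    (identityˡ _)

  sum-≡ : {is : List I} {i : I} (_≟_ : DecidableEquality I) (f : I → Carrier) →
          Unique is → i ∈ˡ is → sum is (λ j → when (j ≟ i) (f j)) ≈ f i
  sum-≡ {i = i} _≟_ f u i∈is = ≈-trans
    (sum-single (λ j → when (j ≟ i) (f j)) u i∈is (λ j _ → when-false (j ≟ i)))
    (when-true (i ≟ i) refl)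

  module _ {js : List J} (_≟_ : DecidableEquality J) (js-unique : Unique js)
           (js-complete : ∀ j → j ∈ˡ js) where

    sum-expand : (i : J) (f : J → Carrier) → f i ≈ sum js (λ j → when (i ≟ j) (f j))
    sum-expand i f = ≈-sym (≈-trans
      (sum-single _ js-unique (js-complete i) (λ j _ j≢i → when-false (i ≟ j) (j≢i ∘ sym)))
      (when-true (i ≟ i) refl))

    -- Each `i` contributes to exactly one `j`, namely `h i`. With `h` the meet or the join, this
    -- eliminates the inner condition of the two coproduct sums.
    sum-fibre : {P : J → Set p} (P? : ∀ j → Dec (P j))
                (is : List I) (h : I → J) (f : I → Carrier) →
                sum js (λ j → when (P? j) (sum is (λ i → when (h i ≟ j) (f i)))) ≈
                sum is (λ i → when (P? (h i)) (f i))
    sum-fibre P? is h f = begin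
      sum js (λ j → when (P? j) (sum is (λ i → when (h i ≟ j) (f i))))
        ≈⟨ sum-cong js (λ j → sum-when (P? j) is _) ⟩
      sum js (λ j → sum is (λ i → when (P? j) (when (h i ≟ j) (f i))))
        ≈⟨ sum-swap js is _ ⟩
      sum is (λ i → sum js (λ j → when (P? j) (when (h i ≟ j) (f i))))
        ≈⟨ sum-cong is (λ i → sum-cong js (λ j → when-swap (P? j) (h i ≟ j))) ⟩
      sum is (λ i → sum js (λ j → when (h i ≟ j) (when (P? j) (f i))))
        ≈⟨ sum-cong is (λ i → sum-expand (h i) (λ j → when (P? j) (f i))) ⟨
      sum is (λ i → when (P? (h i)) (f i)) ∎

    -- The maps have to be mutually inverse only where `P` and `Q` hold. Juxtaposing the two
    -- restrictions of a partition gives it back only when no part crosses the blocks, so products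
    -- call for this partial form.
    sum-reindex : {is : List I} → Unique is → (∀ i → i ∈ˡ is) →
      {P : I → Set p} (P? : ∀ i → Dec (P i)) {Q : J → Set q} (Q? : ∀ j → Dec (Q j))
      (to : I → J) (from : J → I) →
      (∀ i → P i → Q (to i) × from (to i) ≡ i) →
      (∀ j → Q j → P (from j) × to (from j) ≡ j) →
      (f : J → Carrier) →
      sum is (λ i → when (P? i) (f (to i))) ≈ sum js (λ j → when (Q? j) (f j))
    sum-reindex {is = is} is-unique is-complete {P} P? {Q} Q? to from P⇒Q Q⇒P f = begin
      sum is (λ i → when (P? i) (f (to i)))
        ≈⟨ sum-cong is (λ i → sum-expand (to i) (λ j → when (P? i) (f j))) ⟩
      sum is (λ i → sum js (λ j → when (to i ≟ j) (when (P? i) (f j))))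
        ≈⟨ sum-swap is js _ ⟩
      sum js (λ j → sum is (λ i → when (to i ≟ j) (when (P? i) (f j))))
        ≈⟨ sum-cong js (λ j → fibre j (Q? j)) ⟩
      sum js (λ j → when (Q? j) (f j)) ∎
      where
      fibre : ∀ j (q? : Dec (Q j)) →
              sum is (λ i → when (to i ≟ j) (when (P? i) (f j))) ≈ when q? (f j)
      fibre j (yes q) = let (p , to-from) = Q⇒P j q in ≈-trans
        (sum-single _ is-unique (is-complete (from j)) (λ i _ i≢ → ≈-trans
          (when-× (to i ≟ j) (P? i))
          (when-false ((to i ≟ j) ×-dec P? i)
            (λ (to≡j , p) → i≢ (trans (sym (proj₂ (P⇒Q i p))) (cong from to≡j))))))
        (≈-trans (when-true (to (from j) ≟ j) to-from) (when-true (P? (from j)) p))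
      fibre j (no ¬q) = sum-zero is (λ i → ≈-trans
        (when-× (to i ≟ j) (P? i))
        (when-false ((to i ≟ j) ×-dec P? i)
          (λ (to≡j , p) → ¬q (subst Q to≡j (proj₁ (P⇒Q i p))))))

module _ {a ℓa b ℓb} (M : CommutativeMonoid a ℓa) (N : CommutativeMonoid b ℓb) where
  private
    module M = CommutativeMonoid M
    module N = CommutativeMonoid N
    module ∑M = FiniteSums M
    module ∑N = FiniteSums N

  module SumHomomorphism
    (h : M.Carrier → N.Carrier)
    (h-∙ : ∀ x y → h (x M.∙ y) N.≈ h x N.∙ h y)
    (h-ε : h M.ε N.≈ N.ε) where

    sum-hom : ∀ {i} {I : Set i} (is : List I) (f : I → M.Carrier) →
              h (∑M.sum is f) N.≈ ∑N.sum is (h ∘ f)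
    sum-hom []       f = h-ε
    sum-hom (i ∷ is) f = N.trans (h-∙ _ _) (N.∙-congˡ (sum-hom is f))

    when-hom : ∀ {p} {P : Set p} (P? : Dec P) (x : M.Carrier) →
               h (∑M.when P? x) N.≈ ∑N.when P? (h x)
    when-hom (yes _) x = N.refl
    when-hom (no  _) x = h-ε

-- Finite posets.

record FinitePoset : Set₁ where
  field
    Carrier        : Set
    _≤_            : Rel Carrier 0ℓ
    isPartialOrder : IsPartialOrder _≡_ _≤_
    _≟_            : DecidableEquality Carrier
    _≤?_           : Decidable _≤_
    elements       : List Carrier
    unique         : Unique elements
    complete       : ∀ a → a ∈ˡ elements

  open IsPartialOrder isPartialOrder public
    using (antisym) renaming (refl to ≤-refl; trans to ≤-trans; reflexive to ≤-reflexive)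

  infix 4 _<_ _<?_

  _<_ : Rel Carrier 0ℓ
  _<_ = ToStrict._<_ _≡_ _≤_

  _<?_ : Decidable _<_
  a <? b = (a ≤? b) ×-dec ¬? (a ≟ b)

  -- Strict partial orders on `Fin` are well founded. The order is pulled back along the
  -- enumeration, and since every element has an index, `at` carries accessibility from indices to
  -- elements.
  <-wellFounded : WellFounded _<_
  <-wellFounded a = subst (Acc _<_) (sym (lookup-index (complete a)))
    (at (index (complete a)) (spo-wellFounded isStrictPartialOrder (index (complete a))))
    where
    isStrictPartialOrder = On.isStrictPartialOrder (List.lookup elements)
      (ToStrict.<-isStrictPartialOrder _≡_ _≤_ isPartialOrder)
    at : ∀ i → Acc (λ k l → List.lookup elements k < List.lookup elements l) i →
         Acc _<_ (List.lookup elements i)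
    at i (acc rs) = acc λ {b} b<i → subst (Acc _<_) (sym (lookup-index (complete b)))
      (at _ (rs (subst (_< List.lookup elements i) (lookup-index (complete b)) b<i)))

-- Lower sums in the opposite poset are sums over upper sets; inverting these expresses the
-- coefficients of a combination of the `𝐱` through coefficients of power sums.
opposite : FinitePoset → FinitePoset
opposite P = record
  { Carrier = Carrier ; _≤_ = flip _≤_
  ; isPartialOrder = Flip.isPartialOrder isPartialOrder
  ; _≟_ = _≟_ ; _≤?_ = flip _≤?_
  ; elements = elements ; unique = unique ; complete = complete }
  where open FinitePoset P

-- Möbius inversion in an abelian group.

module MöbiusInversion (P : FinitePoset) {c ℓ} (G : AbelianGroup c ℓ) where
  open FinitePoset P renaming (Carrier to ∣P∣)
  open AbelianGroup G renaming (refl to ≈-refl; sym to ≈-sym; trans to ≈-trans)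
  open AbelianGroupProperties G using (∙-cancelʳ)
  open FiniteSums commutativeMonoid
  open SetoidReasoning setoid

  ∑≤ ∑< : (∣P∣ → Carrier) → ∣P∣ → Carrier
  ∑≤ f a = sum elements (λ b → when (b ≤? a) (f b))
  ∑< f a = sum elements (λ b → when (b <? a) (f b))

  ∑≤-cong : ∀ {f g} → (∀ a → f a ≈ g a) → ∀ a → ∑≤ f a ≈ ∑≤ g a
  ∑≤-cong f≈g a = sum-cong elements (λ b → when-cong (b ≤? a) (λ _ → f≈g b))

  ∑≤-split : ∀ f a → ∑≤ f a ≈ f a ∙ ∑< f a
  ∑≤-split f a = begin
    ∑≤ f a
      ≈⟨ sum-cong elements split ⟩
    sum elements (λ b → when (b ≟ a) (f b) ∙ when (b <? a) (f b))
      ≈⟨ sum-∙ elements _ _ ⟩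
    sum elements (λ b → when (b ≟ a) (f b)) ∙ ∑< f a
      ≈⟨ ∙-congʳ (sum-≡ _≟_ f unique (complete a)) ⟩
    f a ∙ ∑< f a ∎
    where
    split : ∀ b → when (b ≤? a) (f b) ≈ when (b ≟ a) (f b) ∙ when (b <? a) (f b)
    split b = by (b ≟ a)
      where
      by : Dec (b ≡ a) → _
      by (yes b≡a) = ≈-trans (when-true (b ≤? a) (≤-reflexive b≡a)) (≈-sym (≈-trans
        (∙-cong (when-true (b ≟ a) b≡a) (when-false (b <? a) (λ (_ , b≢a) → b≢a b≡a)))
        (identityʳ _)))
      by (no  b≢a) = ≈-sym (≈-trans
        (∙-cong (when-false (b ≟ a) b≢a) (when-⇔ (b <? a) (b ≤? a) (mk⇔ proj₁ (_, b≢a))))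
        (identityˡ _))

  -- By induction `f` and `g` agree strictly below `a`, so the `∑<` parts agree and can be
  -- cancelled.
  ∑≤-injective : ∀ f g → (∀ a → ∑≤ f a ≈ ∑≤ g a) → ∀ a → f a ≈ g a
  ∑≤-injective f g ∑f≈∑g a = go a (<-wellFounded a)
    where
    go : ∀ a → Acc _<_ a → f a ≈ g a
    go a (acc rs) = ∙-cancelʳ (∑< g a) (f a) (g a) (begin
      f a ∙ ∑< g a ≈⟨ ∙-congˡ (sum-cong elements (λ b →
                        when-cong (b <? a) (λ b<a → go b (rs b<a)))) ⟨
      f a ∙ ∑< f a ≈⟨ ∑≤-split f a ⟨
      ∑≤ f a       ≈⟨ ∑f≈∑g a ⟩
      ∑≤ g a       ≈⟨ ∑≤-split g a ⟩
      g a ∙ ∑< g a ∎)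

  private
    -- Unlike in `when`, the value may depend on the proof: the recursion in `möbiusAcc` needs
    -- `b < a` to obtain the accessibility of `b`.
    whenDec : ∀ {p} {Q : Set p} → Dec Q → (Q → Carrier) → Carrier
    whenDec (yes q) f = f q
    whenDec (no  _) f = ε

    möbiusAcc : (∣P∣ → Carrier) → ∀ a → Acc _<_ a → Carrier
    möbiusAcc f a (acc rs) =
      f a ∙ sum elements (λ b → whenDec (b <? a) (λ b<a → möbiusAcc f b (rs b<a))) ⁻¹

    whenDec-when : ∀ {p} {Q : Set p} (Q? : Dec Q) (f : Q → Carrier) {x} →
                   (∀ q → f q ≈ x) → whenDec Q? f ≈ when Q? x
    whenDec-when (yes q) f f≈x = f≈x q
    whenDec-when (no  _) f f≈x = ≈-refl

  möbius : (∣P∣ → Carrier) → ∣P∣ → Carrier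
  möbius f a = möbiusAcc f a (<-wellFounded a)

  private
    möbiusAcc-unfold : ∀ f a (r : Acc _<_ a) → möbiusAcc f a r ≈ f a ∙ ∑< (möbius f) a ⁻¹
    -- The recursive call carries `rs b<a`, whereas `möbius` starts afresh from `<-wellFounded b`;
    -- unfolding `möbius` once requires that both give the same value.
    möbiusAcc-irrelevant : ∀ f a (r s : Acc _<_ a) → möbiusAcc f a r ≈ möbiusAcc f a s

    whenDec-cong : ∀ {p} {Q : Set p} (Q? : Dec Q) {f g : Q → Carrier} →
                   (∀ q → f q ≈ g q) → whenDec Q? f ≈ whenDec Q? g
    whenDec-cong (yes q) f≈g = f≈g q
    whenDec-cong (no  _) f≈g = ≈-refl

    möbiusAcc-irrelevant f a (acc rs) (acc ss) =
      ∙-congˡ (⁻¹-cong (sum-cong elements (λ b →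
        whenDec-cong (b <? a) (λ b<a → möbiusAcc-irrelevant f b (rs b<a) (ss b<a)))))

    möbiusAcc-unfold f a (acc rs) = ∙-congˡ (⁻¹-cong (sum-cong elements (λ b →
      whenDec-when (b <? a) _ (λ b<a →
        möbiusAcc-irrelevant f b (rs b<a) (<-wellFounded b)))))

  ∑≤-möbius : ∀ f a → ∑≤ (möbius f) a ≈ f a
  ∑≤-möbius f a = begin
    ∑≤ (möbius f) a
      ≈⟨ ∑≤-split (möbius f) a ⟩
    möbius f a ∙ ∑< (möbius f) a
      ≈⟨ ∙-congʳ (möbiusAcc-unfold f a (<-wellFounded a)) ⟩
    (f a ∙ ∑< (möbius f) a ⁻¹) ∙ ∑< (möbius f) a
      ≈⟨ assoc _ _ _ ⟩
    f a ∙ (∑< (möbius f) a ⁻¹ ∙ ∑< (möbius f) a)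
      ≈⟨ ∙-congˡ (inverseˡ _) ⟩
    f a ∙ ε
      ≈⟨ identityʳ _ ⟩
    f a ∎

-- Set partitions as equivalence relations.

Same : SetPartition n → Fin n → Fin n → Set
Same A i j = j ∈ part A i

same-part : (A : SetPartition n) → ∀ {i j} → Same A i j → part A i ≡ part A j
same-part A {i} {j} s = sym (part-coherent A i j s)

part-same : (A : SetPartition n) → ∀ {i j} → part A i ≡ part A j → Same A i j
part-same A {i} {j} eq = subst (j ∈_) (sym eq) (part-covers A j)

setPartition-≡ : {A B : SetPartition n} → (∀ i → part A i ≡ part B i) → A ≡ B
setPartition-≡ {A = A@(mkSetPartition p _)} {B = B@(mkSetPartition q _)} eq
  with refl ← trans (sym (tabulate∘lookup p)) (trans (tabulate-cong eq) (tabulate∘lookup q))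
  = refl

-- The witness `k` of `A ≤ᵖ B` at `i` need not be `i`, but its part contains `i`, so by coherence it
-- is the part of `i`.
≤ᵖ⇒Same : {A B : SetPartition n} → A ≤ᵖ B → ∀ {i j} → Same A i j → Same B i j
≤ᵖ⇒Same {A = A} {B} A≤B {i} s with A≤B i
... | k , A⊆B = subst (_ ∈_) (sym (part-coherent B k i (A⊆B (part-covers A i)))) (A⊆B s)

Same⇒≤ᵖ : {A B : SetPartition n} → (∀ {i j} → Same A i j → Same B i j) → A ≤ᵖ B
Same⇒≤ᵖ s i = i , s

≤ᵖ-isPartialOrder : IsPartialOrder _≡_ (_≤ᵖ_ {n})
≤ᵖ-isPartialOrder = record
  { isPreorder = record
    { isEquivalence = isEquivalence
    ; reflexive = λ { {A} refl → Same⇒≤ᵖ {A = A} {A} (λ s → s) }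
    ; trans = λ {A} {B} {C} A≤B B≤C →
        Same⇒≤ᵖ {A = A} {C} (≤ᵖ⇒Same {A = B} {C} B≤C ∘ ≤ᵖ⇒Same {A = A} {B} A≤B)
    }
  ; antisym = λ {A} {B} A≤B B≤A → setPartition-≡ λ i →
      ⊆-antisym (≤ᵖ⇒Same {A = A} {B} A≤B) (≤ᵖ⇒Same {A = B} {A} B≤A)
  }

module _ {n : ℕ} where
  open IsPartialOrder (≤ᵖ-isPartialOrder {n}) public
    using () renaming (refl to ≤ᵖ-refl; trans to ≤ᵖ-trans; antisym to ≤ᵖ-antisym)

-- The lattice of set partitions

part-∧ : (A B : SetPartition n) → ∀ i → part (A ∧ B) i ≡ part A i ∩ part B i
part-∧ A B = lookup∘tabulate _

≤-∧ : (D A B : SetPartition n) → D ≤ᵖ A ∧ B ⇔ (D ≤ᵖ A × D ≤ᵖ B)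
≤-∧ D A B = mk⇔
  (λ D≤ → Same⇒≤ᵖ {A = D} {A} (proj₁ ∘ split ∘ ≤ᵖ⇒Same {A = D} {A ∧ B} D≤) ,
          Same⇒≤ᵖ {A = D} {B} (proj₂ ∘ split ∘ ≤ᵖ⇒Same {A = D} {A ∧ B} D≤))
  (λ (D≤A , D≤B) → Same⇒≤ᵖ {A = D} {A ∧ B} λ s → subst (_ ∈_) (sym (part-∧ A B _))
    (x∈p∩q⁺ (≤ᵖ⇒Same {A = D} {A} D≤A s , ≤ᵖ⇒Same {A = D} {B} D≤B s)))
  where
  split : ∀ {i j} → Same (A ∧ B) i j → Same A i j × Same B i j
  split s = x∈p∩q⁻ (part A _) (part B _) (subst (_ ∈_) (part-∧ A B _) s)

≤-𝟏 : (D : SetPartition n) → D ≤ᵖ 𝟏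
≤-𝟏 D = Same⇒≤ᵖ {A = D} {𝟏} λ {i} _ → subst (_ ∈_) (sym (lookup∘tabulate _ i)) ∈⊤

≤-⋀ : (D : SetPartition n) (Es : List (SetPartition n)) →
      D ≤ᵖ foldr _∧_ 𝟏 Es ⇔ (∀ {E} → E ∈ˡ Es → D ≤ᵖ E)
≤-⋀ D [] = mk⇔ (λ _ ()) (λ _ → ≤-𝟏 D)
≤-⋀ D (E ∷ Es) = mk⇔
  (λ D≤ → let (D≤E , D≤Es) = Equivalence.to (≤-∧ D E (foldr _∧_ 𝟏 Es)) D≤ in
    λ { (here refl) → D≤E ; (there E∈) → Equivalence.to (≤-⋀ D Es) D≤Es E∈ })
  (λ D≤ → Equivalence.from (≤-∧ D E (foldr _∧_ 𝟏 Es))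
    (D≤ (here refl) , Equivalence.from (≤-⋀ D Es) (λ E∈ → D≤ (there E∈))))

-- Enumeration

module _ {A : Set} where
  allVecs-unique : {xs : List A} → Unique xs → ∀ n → Unique (allVecs xs n)
  allVecs-unique u zero    = [] ∷ []
  allVecs-unique u (suc n) = cartesianProductWith⁺ _∷_ ∷-injective u (allVecs-unique u n)

  allVecs-complete : {xs : List A} → (∀ a → a ∈ˡ xs) →
                     ∀ {n} (v : Vec A n) → v ∈ˡ allVecs xs n
  allVecs-complete c []      = here refl
  allVecs-complete c (a ∷ v) = ∈-cartesianProductWith⁺ _∷_ (c a) (allVecs-complete c v)

module _ {A B : Set} (f : A → Maybe B) where
  ∈-mapMaybe⁺ : ∀ {xs x y} → x ∈ˡ xs → f x ≡ just y → y ∈ˡ mapMaybe f xs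
  ∈-mapMaybe⁺ {x ∷ xs} (here refl) eq rewrite eq = here refl
  ∈-mapMaybe⁺ {x ∷ xs} (there x∈)  eq with f x
  ... | just _  = there (∈-mapMaybe⁺ x∈ eq)
  ... | nothing = ∈-mapMaybe⁺ x∈ eq

  ∈-mapMaybe⁻ : ∀ {xs y} → y ∈ˡ mapMaybe f xs → ∃ λ x → x ∈ˡ xs × f x ≡ just y
  ∈-mapMaybe⁻ {x ∷ xs} y∈ with f x in eq
  ∈-mapMaybe⁻ {x ∷ xs} (here refl) | just _ = x , here refl , eq
  ∈-mapMaybe⁻ {x ∷ xs} (there y∈) | just _ =
    let (x′ , x′∈ , eq′) = ∈-mapMaybe⁻ y∈ in x′ , there x′∈ , eq′
  ∈-mapMaybe⁻ {x ∷ xs} y∈ | nothing =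
    let (x′ , x′∈ , eq′) = ∈-mapMaybe⁻ y∈ in x′ , there x′∈ , eq′

  mapMaybe-unique : (∀ {x x′ y} → f x ≡ just y → f x′ ≡ just y → x ≡ x′) →
                    ∀ {xs} → Unique xs → Unique (mapMaybe f xs)
  mapMaybe-unique inj [] = []
  mapMaybe-unique inj {x ∷ xs} (x∉ ∷ u) with f x in eq
  ... | nothing = mapMaybe-unique inj u
  ... | just y  = All.tabulate (λ z∈ y≡z →
    let (x′ , x′∈ , eq′) = ∈-mapMaybe⁻ z∈ in
    All.lookup x∉ x′∈ (inj eq (trans eq′ (cong just (sym y≡z))))) ∷ mapMaybe-unique inj u

private
  toSetPartition : Vec (Subset n) n → Maybe (SetPartition n)
  toSetPartition p = Maybe.map (λ P → mkSetPartition p P) (dec⇒maybe (isSetPartition? p))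

  toSetPartition-parts : (p : Vec (Subset n) n) {A : SetPartition n} →
                         toSetPartition p ≡ just A → p ≡ parts A
  toSetPartition-parts p eq with isSetPartition? p
  toSetPartition-parts p refl | yes _ = refl

  parts-toSetPartition : (A : SetPartition n) → toSetPartition (parts A) ≡ just A
  parts-toSetPartition A@(mkSetPartition p P) with isSetPartition? p
  ... | yes _ = refl
  ... | no ¬P = contradiction (record { covers = part-covers A ; coherent = part-coherent A }) ¬P

  sides-unique : Unique (inside ∷ outside ∷ [])
  sides-unique = ((λ ()) ∷ []) ∷ [] ∷ []

  sides-complete : ∀ s → s ∈ˡ (inside ∷ outside ∷ [])
  sides-complete true  = here refl
  sides-complete false = there (here refl)

allSetPartitions-unique : ∀ n → Unique (allSetPartitions n)
allSetPartitions-unique n = mapMaybe-unique toSetPartition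
  (λ {p} {q} eq eq′ → trans (toSetPartition-parts p eq) (sym (toSetPartition-parts q eq′)))
  (allVecs-unique (allVecs-unique sides-unique n) n)

allSetPartitions-complete : (A : SetPartition n) → A ∈ˡ allSetPartitions n
allSetPartitions-complete A = ∈-mapMaybe⁺ toSetPartition
  (allVecs-complete (allVecs-complete sides-complete) (parts A)) (parts-toSetPartition A)

setPartitionPoset : ℕ → FinitePoset
setPartitionPoset n = record
  { Carrier = SetPartition n ; _≤_ = _≤ᵖ_ ; isPartialOrder = ≤ᵖ-isPartialOrder
  ; _≟_ = _≟ᵖ_ ; _≤?_ = _≤ᵖ?_ ; elements = allSetPartitions n
  ; unique = allSetPartitions-unique n ; complete = allSetPartitions-complete }

-- The join is the meet of the list of all common upper bounds: `A` and `B` lie below every member,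
-- and each common bound `D` is a member because the enumeration is complete.
∨-≤ : (A B D : SetPartition n) → A ∨ B ≤ᵖ D ⇔ (A ≤ᵖ D × B ≤ᵖ D)
∨-≤ {n} A B D = mk⇔
  (λ A∨B≤D →
    ≤ᵖ-trans {n} {A} {A ∨ B} {D} (Equivalence.from (≤-⋀ A uppers) (proj₁ ∘ bound)) A∨B≤D ,
    ≤ᵖ-trans {n} {B} {A ∨ B} {D} (Equivalence.from (≤-⋀ B uppers) (proj₂ ∘ bound)) A∨B≤D)
  (λ A,B≤D → Equivalence.to (≤-⋀ (A ∨ B) uppers) (≤ᵖ-refl {n} {A ∨ B})
    (∈-filter⁺ upper? (allSetPartitions-complete D) A,B≤D))
  where
  upper? : ∀ E → Dec (A ≤ᵖ E × B ≤ᵖ E)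
  upper? E = (A ≤ᵖ? E) ×-dec (B ≤ᵖ? E)
  uppers : List (SetPartition n)
  uppers = filter upper? (allSetPartitions n)
  bound : ∀ {E} → E ∈ˡ uppers → A ≤ᵖ E × B ≤ᵖ E
  bound = proj₂ ∘ ∈-filter⁻ upper? {xs = allSetPartitions n}

-- Kernels

-- With `f` the letters of a word this is the partition of its positions; with `f` the parts of a
-- larger partition it is a restriction of that partition.
kernel : {X : Set} → DecidableEquality X → (Fin n → X) → SetPartition n
kernel {n} _≟_ f = fromParts level
  (λ i → lookup⇒[]= i _ (trans (lookup∘tabulate _ i) (dec-true (f i ≟ f i) refl)))
  (λ i j j∈ → tabulate-cong (λ k → cong (λ x → does (x ≟ f k)) (sym (∈-level j∈))))
  where
  level : Fin n → Subset n
  level i = tabulate (λ j → does (f i ≟ f j))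
  ∈-level : ∀ {i j} → j ∈ level i → f i ≡ f j
  ∈-level {i} {j} j∈ with f i ≟ f j | trans (sym (lookup∘tabulate _ j)) ([]=⇒lookup j∈)
  ... | yes eq | _ = eq

module _ {X : Set} (_≟_ : DecidableEquality X) (f : Fin n → X) where
  kernel-same⁻ : ∀ {i j} → Same (kernel _≟_ f) i j → f i ≡ f j
  kernel-same⁻ {i} {j} s with f i ≟ f j | trans (sym (lookup∘tabulate _ j))
    ([]=⇒lookup (subst (j ∈_) (lookup∘tabulate _ i) s))
  ... | yes eq | _ = eq

  kernel-same⁺ : ∀ {i j} → f i ≡ f j → Same (kernel _≟_ f) i j
  kernel-same⁺ {i} {j} eq = subst (j ∈_) (sym (lookup∘tabulate _ i))
    (lookup⇒[]= j _ (trans (lookup∘tabulate _ j) (dec-true (f i ≟ f j) eq)))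

  ≡-kernel : {A : SetPartition n} → (∀ {i j} → Same A i j ⇔ f i ≡ f j) → A ≡ kernel _≟_ f
  ≡-kernel {A} h = setPartition-≡ λ i → ⊆-antisym
    (kernel-same⁺ ∘ Equivalence.to h) (Equivalence.from h ∘ kernel-same⁻)

  ≤-kernel : (A : SetPartition n) →
             A ≤ᵖ kernel _≟_ f ⇔ (∀ i j → Same A i j → f i ≡ f j)
  ≤-kernel A = mk⇔
    (λ A≤ i j s → kernel-same⁻ (≤ᵖ⇒Same {A = A} {kernel _≟_ f} A≤ s))
    (λ h → Same⇒≤ᵖ {A = A} {kernel _≟_ f} (λ s → kernel-same⁺ (h _ _ s)))

-- Juxtaposition

↑-elim : ∀ n {m p} {P : Fin (n ℕ.+ m) → Set p} →
         (∀ i → P (i ↑ˡ m)) → (∀ j → P (n ↑ʳ j)) → ∀ i → P i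
↑-elim n {m} {P = P} l r i with splitAt n i in eq
... | inj₁ k = subst P (splitAt⁻¹-↑ˡ eq) (l k)
... | inj₂ k = subst P (splitAt⁻¹-↑ʳ eq) (r k)

module _ (A : SetPartition n) (B : SetPartition m) where
  private
    p : Fin n ⊎ Fin m → Subset (n ℕ.+ m)
    p = [ (λ i → part A i ++ ⊥) , (λ j → ⊥ ++ part B j) ]′

  part-∣ˡ : ∀ i → part (A ∣ B) (i ↑ˡ m) ≡ part A i ++ ⊥
  part-∣ˡ i = trans (lookup∘tabulate _ (i ↑ˡ m)) (cong p (splitAt-↑ˡ n i m))

  part-∣ʳ : ∀ j → part (A ∣ B) (n ↑ʳ j) ≡ ⊥ ++ part B j
  part-∣ʳ j = trans (lookup∘tabulate _ (n ↑ʳ j)) (cong p (splitAt-↑ʳ n m j))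

module _ {p : Subset n} {q : Subset m} where
  ∈-++ˡ : ∀ {i} → i ↑ˡ m ∈ p ++ q ⇔ i ∈ p
  ∈-++ˡ {i} = mk⇔
    (λ i∈ → lookup⇒[]= i p (trans (sym (lookup-++ˡ p q i)) ([]=⇒lookup i∈)))
    (λ i∈ → lookup⇒[]= _ (p ++ q) (trans (lookup-++ˡ p q i) ([]=⇒lookup i∈)))

  ∈-++ʳ : ∀ {j} → n ↑ʳ j ∈ p ++ q ⇔ j ∈ q
  ∈-++ʳ {j} = mk⇔
    (λ j∈ → lookup⇒[]= j q (trans (sym (lookup-++ʳ p q j)) ([]=⇒lookup j∈)))
    (λ j∈ → lookup⇒[]= _ (p ++ q) (trans (lookup-++ʳ p q j) ([]=⇒lookup j∈)))

module _ (A : SetPartition n) (B : SetPartition m) where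
  same-∣ˡ : ∀ {i j} → Same (A ∣ B) (i ↑ˡ m) (j ↑ˡ m) ⇔ Same A i j
  same-∣ˡ {i} = mk⇔
    (Equivalence.to ∈-++ˡ ∘ subst (_ ∈_) (part-∣ˡ A B i))
    (subst (_ ∈_) (sym (part-∣ˡ A B i)) ∘ Equivalence.from ∈-++ˡ)

  same-∣ʳ : ∀ {i j} → Same (A ∣ B) (n ↑ʳ i) (n ↑ʳ j) ⇔ Same B i j
  same-∣ʳ {i} = mk⇔
    (Equivalence.to (∈-++ʳ {p = ⊥ {n}}) ∘ subst (_ ∈_) (part-∣ʳ A B i))
    (subst (_ ∈_) (sym (part-∣ʳ A B i)) ∘ Equivalence.from (∈-++ʳ {p = ⊥ {n}}))

  ¬same-∣ˡʳ : ∀ {i j} → ¬ Same (A ∣ B) (i ↑ˡ m) (n ↑ʳ j)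
  ¬same-∣ˡʳ {i} s = ∉⊥ (Equivalence.to (∈-++ʳ {p = part A i}) (subst (_ ∈_) (part-∣ˡ A B i) s))

  ¬same-∣ʳˡ : ∀ {i j} → ¬ Same (A ∣ B) (n ↑ʳ j) (i ↑ˡ m)
  ¬same-∣ʳˡ {i} {j} s = ∉⊥ (Equivalence.to (∈-++ˡ {q = part B j}) (subst (_ ∈_) (part-∣ʳ A B j) s))

-- No part of `A ∣ B` contains positions from both blocks, so mixed pairs impose no condition. The
-- relation `R` is left open to serve both for `Same D` and for equality of letters.
same-∣-elim : (A : SetPartition n) (B : SetPartition m) {R : Fin (n ℕ.+ m) → Fin (n ℕ.+ m) → Set} →
  (∀ i j → Same (A ∣ B) i j → R i j) ⇔
  ((∀ i j → Same A i j → R (i ↑ˡ m) (j ↑ˡ m)) ×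
   (∀ i j → Same B i j → R (n ↑ʳ i) (n ↑ʳ j)))
same-∣-elim {n} {m} A B {R} = mk⇔
  (λ h → (λ i j → h _ _ ∘ Equivalence.from (same-∣ˡ A B)) ,
         (λ i j → h _ _ ∘ Equivalence.from (same-∣ʳ A B)))
  (λ (l , r) → ↑-elim n
    (λ i → ↑-elim n (λ j → l i j ∘ Equivalence.to (same-∣ˡ A B))
                    (λ j s → contradiction s (¬same-∣ˡʳ A B)))
    (λ i → ↑-elim n (λ j s → contradiction s (¬same-∣ʳˡ A B))
                    (λ j → r i j ∘ Equivalence.to (same-∣ʳ A B))))

restrictˡ : ∀ n {m} → SetPartition (n ℕ.+ m) → SetPartition n
restrictˡ n {m} D = kernel _≟ˢ_ (λ i → part D (i ↑ˡ m))

restrictʳ : ∀ n {m} → SetPartition (n ℕ.+ m) → SetPartition m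
restrictʳ n {m} D = kernel _≟ˢ_ (λ j → part D (n ↑ʳ j))

-- Every part of `A ∣ B` lies in one block, so refinement can be tested block by block. In other
-- words, restriction is right adjoint to juxtaposition.
∣-≤ : (A : SetPartition n) (B : SetPartition m) (D : SetPartition (n ℕ.+ m)) →
      A ∣ B ≤ᵖ D ⇔ (A ≤ᵖ restrictˡ n D × B ≤ᵖ restrictʳ n D)
∣-≤ {n} {m} A B D = mk⇔
  (λ h → let (l , r) = Equivalence.to (same-∣-elim A B {Same D}) (λ i j → ≤ᵖ⇒Same {A = A ∣ B} {D} h) in
    Equivalence.from (≤-kernel _≟ˢ_ _ A) (λ i j s → same-part D (l i j s)) ,
    Equivalence.from (≤-kernel _≟ˢ_ _ B) (λ i j s → same-part D (r i j s)))
  (λ (l , r) → Same⇒≤ᵖ {A = A ∣ B} {D} (Equivalence.from (same-∣-elim A B {Same D})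
    ((λ i j s → part-same D (Equivalence.to (≤-kernel _≟ˢ_ (λ i → part D (i ↑ˡ m)) A) l i j s)) ,
     (λ i j s → part-same D (Equivalence.to (≤-kernel _≟ˢ_ (λ j → part D (n ↑ʳ j)) B) r i j s))) _ _))

restrictˡ-∣ : (A : SetPartition n) (B : SetPartition m) → restrictˡ n (A ∣ B) ≡ A
restrictˡ-∣ A B = sym (≡-kernel _≟ˢ_ _ (mk⇔
  (same-part (A ∣ B) ∘ Equivalence.from (same-∣ˡ A B))
  (Equivalence.to (same-∣ˡ A B) ∘ part-same (A ∣ B))))

restrictʳ-∣ : (A : SetPartition n) (B : SetPartition m) → restrictʳ n (A ∣ B) ≡ B
restrictʳ-∣ A B = sym (≡-kernel _≟ˢ_ _ (mk⇔
  (same-part (A ∣ B) ∘ Equivalence.from (same-∣ʳ A B))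
  (Equivalence.to (same-∣ʳ A B) ∘ part-same (A ∣ B))))

-- For general `D` the juxtaposed restrictions are only finer than `D`. Below `A ∣ B` no part of `D`
-- crosses the blocks, so cutting at the boundary loses nothing.
∣-restrict : (A : SetPartition n) (B : SetPartition m) {D : SetPartition (n ℕ.+ m)} →
             D ≤ᵖ A ∣ B → restrictˡ n D ∣ restrictʳ n D ≡ D
∣-restrict {n} {m} A B {D} D≤ = ≤ᵖ-antisym
  (Equivalence.from (∣-≤ (restrictˡ n D) (restrictʳ n D) D)
    (≤ᵖ-refl {n} {restrictˡ n D} , ≤ᵖ-refl {m} {restrictʳ n D}))
  (Same⇒≤ᵖ {A = D} {D′} λ {i} {j} → ↑-elim n {P = λ i → ∀ j → Same D i j → Same D′ i j}
    (λ i → ↑-elim n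
      (λ j s → Equivalence.from (same-∣ˡ (restrictˡ n D) (restrictʳ n D))
                 (kernel-same⁺ _≟ˢ_ _ (same-part D s)))
      (λ j s → contradiction (≤ᵖ⇒Same {A = D} {A ∣ B} D≤ s) (¬same-∣ˡʳ A B)))
    (λ i → ↑-elim n
      (λ j s → contradiction (≤ᵖ⇒Same {A = D} {A ∣ B} D≤ s) (¬same-∣ʳˡ A B))
      (λ j s → Equivalence.from (same-∣ʳ (restrictˡ n D) (restrictʳ n D))
                 (kernel-same⁺ _≟ˢ_ _ (same-part D s))))
    i j)
  where
  D′ : SetPartition (n ℕ.+ m)
  D′ = restrictˡ n D ∣ restrictʳ n D

∣-mono : (A′ : SetPartition n) (B′ : SetPartition m) (A : SetPartition n) (B : SetPartition m) →
         A′ ≤ᵖ A → B′ ≤ᵖ B → A′ ∣ B′ ≤ᵖ A ∣ B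
∣-mono {n} A′ B′ A B A′≤A B′≤B = Equivalence.from (∣-≤ A′ B′ (A ∣ B))
  (subst (A′ ≤ᵖ_) (sym (restrictˡ-∣ A B)) A′≤A , subst (B′ ≤ᵖ_) (sym (restrictʳ-∣ A B)) B′≤B)

∣-mono⁻ : (A′ : SetPartition n) (B′ : SetPartition m) (A : SetPartition n) (B : SetPartition m) →
          A′ ∣ B′ ≤ᵖ A ∣ B → A′ ≤ᵖ A × B′ ≤ᵖ B
∣-mono⁻ A′ B′ A B le = let (l , r) = Equivalence.to (∣-≤ A′ B′ (A ∣ B)) le in
  subst (A′ ≤ᵖ_) (restrictˡ-∣ A B) l , subst (B′ ≤ᵖ_) (restrictʳ-∣ A B) r

-- Words and their kernels.

wordKernel : Vec ℕ n → SetPartition n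
wordKernel v = kernel ℕ._≟_ (lookup v)

-- Words of known length are handled as vectors, which removes the index casts hidden in `letter`.
toList-surjective : ∀ w → n ≡ length w → ∃ λ (v : Vec ℕ n) → w ≡ toList v
toList-surjective w refl = fromList w , sym (toList∘fromList w)

letter-toList : (v : Vec ℕ n) .(eq : n ≡ length (toList v)) → ∀ a →
                letter (toList v) eq a ≡ lookup v a
letter-toList (x ∷ v) eq zero    = refl
letter-toList (x ∷ v) eq (suc a) = letter-toList v (cong ℕ.pred eq) a

-- A word determines its kernel, so evaluating a combination of the `𝐦` on a word selects a single
-- term.
hasKernel-toList : (A : SetPartition n) (v : Vec ℕ n) →
                   HasKernel A (toList v) ⇔ A ≡ wordKernel v
hasKernel-toList A v = mk⇔
  (λ (eq , h) → ≡-kernel ℕ._≟_ (lookup v) (λ {i} {j} → mk⇔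
    (λ s → subst₂ _≡_ (letter-toList v eq i) (letter-toList v eq j) (Equivalence.from (h i j) s))
    (λ e → Equivalence.to (h i j)
      (trans (letter-toList v eq i) (trans e (sym (letter-toList v eq j)))))))
  (λ { refl → let eq = sym (length-toList v) in eq , λ i j → mk⇔
    (λ e → kernel-same⁺ ℕ._≟_ (lookup v)
      (trans (sym (letter-toList v eq i)) (trans e (letter-toList v eq j))))
    (λ s → trans (letter-toList v eq i)
      (trans (kernel-same⁻ ℕ._≟_ (lookup v) s) (sym (letter-toList v eq j)))) })

-- On the empty subset of `Fin n` the function `leastElement` takes the default value `n`, which is
-- no element; hence the inhabitant `i`.
leastElement-∈ : ∀ {p : Subset n} {i} → i ∈ p → ∃ λ k → k ∈ p × toℕ k ≡ leastElement p
leastElement-∈ {p = inside  ∷ p} _          = zero , here , refl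
leastElement-∈ {p = outside ∷ p} (there i∈) =
  let (k , k∈ , eq) = leastElement-∈ i∈ in suc k , there k∈ , cong suc eq

canonicalVec : SetPartition n → Vec ℕ n
canonicalVec A = Vec.map leastElement (parts A)

-- Parts with the same least element share that element and therefore coincide, so the letters of
-- the canonical word separate the parts.
wordKernel-canonical : (A : SetPartition n) → wordKernel (canonicalVec A) ≡ A
wordKernel-canonical A = sym (≡-kernel ℕ._≟_ (lookup (canonicalVec A)) (λ {i} {j} → mk⇔
  (λ s → trans (lookup-map i leastElement (parts A))
    (trans (cong leastElement (same-part A s)) (sym (lookup-map j leastElement (parts A)))))
  (λ e → least⇒same (trans (sym (lookup-map i leastElement (parts A)))
    (trans e (lookup-map j leastElement (parts A)))))))
  where
  least⇒same : ∀ {i j} → leastElement (part A i) ≡ leastElement (part A j) → Same A i j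
  least⇒same {i} {j} e with leastElement-∈ (part-covers A i) | leastElement-∈ (part-covers A j)
  ... | k , k∈ , ek | l , l∈ , el with refl ← toℕ-injective (trans ek (trans e (sym el))) =
    part-same A (trans (same-part A k∈) (sym (same-part A l∈)))

take-toList : (u : Vec ℕ n) (v : Vec ℕ m) → take n (toList (u ++ v)) ≡ toList u
take-toList []      v = refl
take-toList (x ∷ u) v = cong (x List.∷_) (take-toList u v)

drop-toList : (u : Vec ℕ n) (v : Vec ℕ m) → drop n (toList (u ++ v)) ≡ toList v
drop-toList []      v = refl
drop-toList (x ∷ u) v = drop-toList u v

-- The letters of `u` are never compared with those of `v`, because no part of `A ∣ B` meets both
-- factors. This is the multiplicativity of the power sums, read on one word.
∣-≤-wordKernel : (A : SetPartition n) (B : SetPartition m) (u : Vec ℕ n) (v : Vec ℕ m) →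
  A ∣ B ≤ᵖ wordKernel (u ++ v) ⇔ (A ≤ᵖ wordKernel u × B ≤ᵖ wordKernel v)
∣-≤-wordKernel {n} {m} A B u v = mk⇔
  (λ A∣B≤ →
    let (l , r) = Equivalence.to blocks (Equivalence.to (≤-kernel ℕ._≟_ (lookup (u ++ v)) (A ∣ B)) A∣B≤)
    in Equivalence.from (≤-kernel ℕ._≟_ (lookup u) A)
         (λ i j s → subst₂ _≡_ (lookup-++ˡ u v i) (lookup-++ˡ u v j) (l i j s)) ,
       Equivalence.from (≤-kernel ℕ._≟_ (lookup v) B)
         (λ i j s → subst₂ _≡_ (lookup-++ʳ u v i) (lookup-++ʳ u v j) (r i j s)))
  (λ (A≤ , B≤) → Equivalence.from (≤-kernel ℕ._≟_ (lookup (u ++ v)) (A ∣ B)) (Equivalence.from blocks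
    ( (λ i j s → trans (lookup-++ˡ u v i)
        (trans (Equivalence.to (≤-kernel ℕ._≟_ (lookup u) A) A≤ i j s) (sym (lookup-++ˡ u v j))))
    , (λ i j s → trans (lookup-++ʳ u v i)
        (trans (Equivalence.to (≤-kernel ℕ._≟_ (lookup v) B) B≤ i j s) (sym (lookup-++ʳ u v j)))))))
  where
  blocks = same-∣-elim A B {λ i j → lookup (u ++ v) i ≡ lookup (u ++ v) j}

-- Renaming the letters of a word

module _ (a b : ℕ) where
  swap : ℕ → ℕ
  swap x with x ℕ.≟ a
  ... | yes _ = b
  ... | no  _ with x ℕ.≟ b
  ...   | yes _ = a
  ...   | no  _ = x

  swap-a : swap a ≡ b
  swap-a with a ℕ.≟ a
  ... | yes _   = refl
  ... | no  a≢a = contradiction refl a≢a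

  swap-b : swap b ≡ a
  swap-b with b ℕ.≟ a
  ... | yes b≡a = b≡a
  ... | no  _ with b ℕ.≟ b
  ...   | yes _   = refl
  ...   | no  b≢b = contradiction refl b≢b

  swap-other : ∀ {x} → x ≢ a → x ≢ b → swap x ≡ x
  swap-other {x} x≢a x≢b with x ℕ.≟ a
  ... | yes x≡a = contradiction x≡a x≢a
  ... | no  _ with x ℕ.≟ b
  ...   | yes x≡b = contradiction x≡b x≢b
  ...   | no  _   = refl

  swap-involutive : ∀ x → swap (swap x) ≡ x
  swap-involutive x = by (x ℕ.≟ a) (x ℕ.≟ b)
    where
    by : Dec (x ≡ a) → Dec (x ≡ b) → swap (swap x) ≡ x
    by (yes refl) _          = trans (cong swap swap-a) swap-b
    by (no _)     (yes refl) = trans (cong swap swap-b) swap-a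
    by (no x≢a)   (no x≢b)   = trans (cong swap (swap-other x≢a x≢b)) (swap-other x≢a x≢b)

  swap↔ : ℕ ↔ ℕ
  swap↔ = mk↔ₛ′ swap swap swap-involutive swap-involutive

-- Symmetry is invariance under bijections of all of ℕ, so a matching of the letters that occur is
-- not enough. The bijection is a composite of transpositions, one for each new letter of `u`.
renameLetters : (u v : Vec ℕ n) →
  (∀ i j → lookup u i ≡ lookup u j ⇔ lookup v i ≡ lookup v j) →
  ∃ λ (σ : ℕ ↔ ℕ) → ∀ i → Inverse.to σ (lookup u i) ≡ lookup v i
renameLetters [] [] h = ↔-id ℕ , λ ()
renameLetters (a ∷ u) (b ∷ v) h with renameLetters u v (λ i j → h (suc i) (suc j))
... | σ , σu≡v with any? (λ i → lookup u i ℕ.≟ a)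
-- The letter `a` already occurs in `u` at `i`, so `σ` sends it to the letter of `v` at `i`, which
-- equals `b` by `h`.
...   | yes (i , uᵢ≡a) = σ , λ
  { zero    → trans (cong (Inverse.to σ) (sym uᵢ≡a))
                    (trans (σu≡v i) (Equivalence.to (h (suc i) zero) uᵢ≡a))
  ; (suc i) → σu≡v i }
-- The transposition moves `σ a` to `b` and leaves the earlier images alone: none is `σ a`, since
-- `a` is not in `u` and `σ` is injective, and none is `b`, since `h` would then put `a` in `u`.
...   | no  a∉u = swap↔ (Inverse.to σ a) b ↔-∘ σ , λ
  { zero    → swap-a (Inverse.to σ a) b
  ; (suc i) → trans (swap-other _ b
      (λ e → a∉u (i , to-injective e))
      (λ e → a∉u (i , Equivalence.from (h (suc i) zero) (trans (sym (σu≡v i)) e))))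
      (σu≡v i) }
  where
  to-injective : ∀ {x y} → Inverse.to σ x ≡ Inverse.to σ y → x ≡ y
  to-injective {x} {y} e = trans (sym (Inverse.strictlyInverseʳ σ x))
    (trans (cong (Inverse.from σ) e) (Inverse.strictlyInverseʳ σ y))

map-toList : ∀ (f : ℕ → ℕ) (u v : Vec ℕ n) → (∀ i → f (lookup u i) ≡ lookup v i) →
             List.map f (toList u) ≡ toList v
map-toList f []      []      h = refl
map-toList f (a ∷ u) (b ∷ v) h = cong₂ List._∷_ (h zero) (map-toList f u v (h ∘ suc))

renameWord : (u v : Vec ℕ n) → wordKernel u ≡ wordKernel v →
           ∃ λ (σ : ℕ ↔ ℕ) → List.map (Inverse.to σ) (toList u) ≡ toList v
renameWord u v ker≡ =
  let (σ , h) = renameLetters u v (λ i j → mk⇔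
        (λ e → kernel-same⁻ ℕ._≟_ (lookup v)
          (subst (λ A → Same A i j) ker≡ (kernel-same⁺ ℕ._≟_ (lookup u) e)))
        (λ e → kernel-same⁻ ℕ._≟_ (lookup u)
          (subst (λ A → Same A i j) (sym ker≡) (kernel-same⁺ ℕ._≟_ (lookup v) e))))
  in σ , map-toList (Inverse.to σ) u v h

-- The family `𝐱` and its coefficients.

module Basis {c ℓ} (K : Field c ℓ) where
  private module K = Field K
  open K using (Carrier; _≈_; _+_; _*_; 0#; 1#)
  open NCSymmetric K
  open Module ncsym using (_*ₗ_; 0ᴹ)
  open FiniteSums K.+-commutativeMonoid
  open SetoidReasoning K.setoid
  private
    module Möb (n : ℕ) = MöbiusInversion (setPartitionPoset n) K.+-abelianGroup
    module Möbᵒ (n : ℕ) = MöbiusInversion (opposite (setPartitionPoset n)) K.+-abelianGroup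
    module *ʳ (a : Carrier) = SumHomomorphism K.+-commutativeMonoid K.+-commutativeMonoid
      (_* a) (K.distribʳ a) (K.zeroˡ a)
    module *ˡ (a : Carrier) = SumHomomorphism K.+-commutativeMonoid K.+-commutativeMonoid
      (a *_) (K.distribˡ a) (K.zeroʳ a)

  when-1-*ˡ : ∀ {p} {P : Set p} (P? : Dec P) a → when P? 1# * a ≈ when P? a
  when-1-*ˡ P? a = K.trans (*ʳ.when-hom a P? 1#) (when-cong P? (λ _ → K.*-identityˡ a))

  when-1-*ʳ : ∀ {p} {P : Set p} (P? : Dec P) a → a * when P? 1# ≈ when P? a
  when-1-*ʳ P? a = K.trans (K.*-comm a _) (when-1-*ˡ P? a)

  -- In terms of the Möbius function μ, `ξ A C` is the sum of μ(B, A) over all `B` below both `A`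
  -- and `C`; it is the coefficient of `𝐦 C` in `𝐱 A`. Inversion acts on the first argument, with
  -- `C` fixed.
  ζ ξ : SetPartition n → SetPartition n → Carrier
  ζ A C = when (A ≤ᵖ? C) 1#
  ξ {n} A C = Möb.möbius n (λ B → ζ B C) A

  ∑≤-ξ : (C A : SetPartition n) → Möb.∑≤ n (λ B → ξ B C) A ≈ ζ A C
  ∑≤-ξ {n} C = Möb.∑≤-möbius n (λ B → ζ B C)

  -- The coefficient of 𝐱_A on a word only depends on the kernel C of the word,
  -- and Σ_{B ≤ A} 𝐱_B = Σ_{C ≥ A} 𝐦_C.
  𝐱 : SetPartition n → NCSym
  𝐱 {n} A = record
    { coeff = coeff𝐱
    ; symmetric = λ σ w → sum-cong (allSetPartitions n) (λ C → K.*-congˡ (symmetric (𝐦 C) σ w))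
    ; degree = n
    ; bounded = λ w n<w → sum-zero (allSetPartitions n) (λ C →
        K.trans (K.*-congˡ (bounded (𝐦 C) w n<w)) (K.zeroʳ _))
    }
    where
    coeff𝐱 : Word → Carrier
    coeff𝐱 w = sum (allSetPartitions n) (λ C → ξ A C * coeff (𝐦 C) w)

  𝐱-homogeneous : (A : SetPartition n) → IsHomogeneous n (𝐱 A)
  𝐱-homogeneous A w w≢n = sum-zero (allSetPartitions _) (λ C → K.trans
    (K.*-congˡ (when-false (hasKernel? C w) (w≢n ∘ sym ∘ proj₁))) (K.zeroʳ _))

  coeff-𝐦 : (B : SetPartition n) (v : Vec ℕ n) →
            coeff (𝐦 B) (toList v) ≈ when (B ≟ᵖ wordKernel v) 1#
  coeff-𝐦 B v = when-⇔ (hasKernel? B (toList v)) (B ≟ᵖ wordKernel v) (hasKernel-toList B v)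

  coeff-𝐱 : (A : SetPartition n) (v : Vec ℕ n) → coeff (𝐱 A) (toList v) ≈ ξ A (wordKernel v)
  coeff-𝐱 {n} A v = begin
    sum (allSetPartitions n) (λ C → ξ A C * coeff (𝐦 C) (toList v))
      ≈⟨ sum-cong (allSetPartitions n) (λ C → K.trans (K.*-congˡ (coeff-𝐦 C v))
           (when-1-*ʳ (C ≟ᵖ wordKernel v) (ξ A C))) ⟩
    sum (allSetPartitions n) (λ C → when (C ≟ᵖ wordKernel v) (ξ A C))
      ≈⟨ sum-≡ _≟ᵖ_ (ξ A) (allSetPartitions-unique n) (allSetPartitions-complete (wordKernel v)) ⟩
    ξ A (wordKernel v) ∎

  -- Products

  ∑≤-∣ : (A : SetPartition n) (B : SetPartition m) (f : SetPartition (n ℕ.+ m) → Carrier) →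
         Möb.∑≤ m (λ B′ → Möb.∑≤ n (λ A′ → f (A′ ∣ B′)) A) B ≈ Möb.∑≤ (n ℕ.+ m) f (A ∣ B)
  ∑≤-∣ {n} {m} A B f = begin
    sum Πm (λ B′ → when (B′ ≤ᵖ? B) (sum Πn (λ A′ → when (A′ ≤ᵖ? A) (f (A′ ∣ B′)))))
      ≈⟨ sum-cong Πm (λ B′ → K.trans (sum-when (B′ ≤ᵖ? B) Πn _) (sum-cong Πn (λ A′ →
           when-× (B′ ≤ᵖ? B) (A′ ≤ᵖ? A)))) ⟩
    sum Πm (λ B′ → sum Πn (λ A′ → when ((B′ ≤ᵖ? B) ×-dec (A′ ≤ᵖ? A)) (f (A′ ∣ B′))))
      ≈⟨ sum-cartesianProduct Πm Πn _ ⟨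
    sum (cartesianProduct Πm Πn) (λ (B′ , A′) →
      when ((B′ ≤ᵖ? B) ×-dec (A′ ≤ᵖ? A)) (f (A′ ∣ B′)))
      ≈⟨ sum-reindex _≟ᵖ_ (allSetPartitions-unique _) allSetPartitions-complete
           (cartesianProduct⁺ (allSetPartitions-unique m) (allSetPartitions-unique n))
           (λ (B′ , A′) → ∈-cartesianProduct⁺
             (allSetPartitions-complete B′) (allSetPartitions-complete A′))
           (λ (B′ , A′) → (B′ ≤ᵖ? B) ×-dec (A′ ≤ᵖ? A)) (_≤ᵖ? (A ∣ B))
           (λ (B′ , A′) → A′ ∣ B′) (λ D → restrictʳ n D , restrictˡ n D)
           (λ (B′ , A′) (B′≤B , A′≤A) →
             ∣-mono A′ B′ A B A′≤A B′≤B ,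
             cong₂ _,_ (restrictʳ-∣ A′ B′) (restrictˡ-∣ A′ B′))
           (λ D D≤ → let D≡ = ∣-restrict A B D≤
                         (l , r) = ∣-mono⁻ (restrictˡ n D) (restrictʳ n D) A B
                                     (subst (_≤ᵖ A ∣ B) (sym D≡) D≤)
                     in (r , l) , D≡)
           f ⟩
    sum (allSetPartitions (n ℕ.+ m)) (λ D → when (D ≤ᵖ? (A ∣ B)) (f D)) ∎
    where
    Πn = allSetPartitions n
    Πm = allSetPartitions m

  -- Summing over lower sets in both `A` and `B` turns every `ξ` into `ζ`, and for `ζ` the claim is
  -- the hypothesis on `R`. It is used with `P`, `Q`, `R` the kernels of two words and of their
  -- concatenation.
  ξ-∣ : (P : SetPartition n) (Q : SetPartition m) (R : SetPartition (n ℕ.+ m)) →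
        (∀ A B → A ∣ B ≤ᵖ R ⇔ (A ≤ᵖ P × B ≤ᵖ Q)) →
        ∀ A B → ξ A P * ξ B Q ≈ ξ (A ∣ B) R
  ξ-∣ {n} {m} P Q R ∣-≤R A B =
    -- One inversion in `A` with `B` fixed and one in `B` with `A` fixed leave an identity of double
    -- lower sums.
    Möb.∑≤-injective n (λ A → ξ A P * ξ B Q) (λ A → ξ (A ∣ B) R) (λ A →
      Möb.∑≤-injective m (λ B → Möb.∑≤ n (λ A → ξ A P * ξ B Q) A)
                         (λ B → Möb.∑≤ n (λ A → ξ (A ∣ B) R) A) (step A) B) A
    where
    ∑≤-*ʳ : ∀ {k} (f : SetPartition k → Carrier) a C →
            Möb.∑≤ k (λ D → f D * a) C ≈ Möb.∑≤ k f C * a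
    ∑≤-*ʳ {k} f a C = K.sym (K.trans (*ʳ.sum-hom a (allSetPartitions k) _)
      (sum-cong (allSetPartitions k) (λ D → *ʳ.when-hom a (D ≤ᵖ? C) (f D))))

    step : ∀ A B → Möb.∑≤ m (λ B → Möb.∑≤ n (λ A → ξ A P * ξ B Q) A) B ≈
                   Möb.∑≤ m (λ B → Möb.∑≤ n (λ A → ξ (A ∣ B) R) A) B
    step A B = begin
      Möb.∑≤ m (λ B → Möb.∑≤ n (λ A → ξ A P * ξ B Q) A) B
        ≈⟨ Möb.∑≤-cong m (λ B → K.trans (∑≤-*ʳ (λ A → ξ A P) (ξ B Q) A)
             (K.trans (K.*-congʳ (∑≤-ξ P A)) (K.*-comm _ _))) B ⟩
      Möb.∑≤ m (λ B → ξ B Q * ζ A P) B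
        ≈⟨ ∑≤-*ʳ (λ B → ξ B Q) (ζ A P) B ⟩
      Möb.∑≤ m (λ B → ξ B Q) B * ζ A P
        ≈⟨ K.trans (K.*-congʳ (∑≤-ξ Q B)) (K.*-comm _ _) ⟩
      ζ A P * ζ B Q
        ≈⟨ K.trans (when-1-*ˡ (A ≤ᵖ? P) _) (when-× (A ≤ᵖ? P) (B ≤ᵖ? Q)) ⟩
      when ((A ≤ᵖ? P) ×-dec (B ≤ᵖ? Q)) 1#
        ≈⟨ when-⇔ (A ∣ B ≤ᵖ? R) ((A ≤ᵖ? P) ×-dec (B ≤ᵖ? Q)) (∣-≤R A B) ⟨
      ζ (A ∣ B) R
        ≈⟨ ∑≤-ξ R (A ∣ B) ⟨
      Möb.∑≤ (n ℕ.+ m) (λ D → ξ D R) (A ∣ B)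
        ≈⟨ ∑≤-∣ A B (λ D → ξ D R) ⟨
      Möb.∑≤ m (λ B → Möb.∑≤ n (λ A → ξ (A ∣ B) R) A) B ∎

  module _ (A : SetPartition n) (B : SetPartition m) where
    private
      term : Word → ℕ → Carrier
      term w i = coeff (𝐱 A) (take i w) * coeff (𝐱 B) (drop i w)

    𝐱-⊙-homogeneous : IsHomogeneous (n ℕ.+ m) (𝐱 A ⊙ 𝐱 B)
    𝐱-⊙-homogeneous w w≢ = sum-zero (upTo (suc (length w))) (λ i →
      vanish i (length (take i w) ℕ.≟ n) (length (drop i w) ℕ.≟ m))
      where
      vanish : ∀ i → Dec (length (take i w) ≡ n) → Dec (length (drop i w) ≡ m) → term w i ≈ 0#
      vanish i (no ≢n)  _       = K.trans (K.*-congʳ (𝐱-homogeneous A _ ≢n)) (K.zeroˡ _)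
      vanish i (yes _)  (no ≢m) = K.trans (K.*-congˡ (𝐱-homogeneous B _ ≢m)) (K.zeroʳ _)
      vanish i (yes ≡n) (yes ≡m) = contradiction
        (trans (cong length (sym (take++drop≡id i w)))
          (trans (length-++ (take i w)) (cong₂ ℕ._+_ ≡n ≡m))) w≢

    -- By homogeneity only the cut after the first `n` letters contributes, so the product of series
    -- reduces to one product of `ξ` entries.
    coeff-𝐱-⊙ : (u : Vec ℕ n) (v : Vec ℕ m) →
                coeff (𝐱 A ⊙ 𝐱 B) (toList (u ++ v)) ≈ coeff (𝐱 (A ∣ B)) (toList (u ++ v))
    coeff-𝐱-⊙ u v = begin
      sum (upTo (suc (length w))) (term w)
        ≈⟨ sum-single (term w) (upTo⁺ _) (∈-upTo⁺ (ℕ.s≤s n≤w)) vanish ⟩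
      coeff (𝐱 A) (take n w) * coeff (𝐱 B) (drop n w)
        ≈⟨ K.*-cong (K.reflexive (cong (coeff (𝐱 A)) (take-toList u v)))
                    (K.reflexive (cong (coeff (𝐱 B)) (drop-toList u v))) ⟩
      coeff (𝐱 A) (toList u) * coeff (𝐱 B) (toList v)
        ≈⟨ K.*-cong (coeff-𝐱 A u) (coeff-𝐱 B v) ⟩
      ξ A (wordKernel u) * ξ B (wordKernel v)
        ≈⟨ ξ-∣ (wordKernel u) (wordKernel v) (wordKernel (u ++ v))
             (λ A B → ∣-≤-wordKernel A B u v) A B ⟩
      ξ (A ∣ B) (wordKernel (u ++ v))
        ≈⟨ coeff-𝐱 (A ∣ B) (u ++ v) ⟨
      coeff (𝐱 (A ∣ B)) w ∎
      where
      w = toList (u ++ v)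
      n≤w : n ℕ.≤ length w
      n≤w = subst (n ℕ.≤_) (sym (length-toList (u ++ v))) (ℕₚ.m≤m+n n m)
      vanish : ∀ i → i ∈ˡ upTo (suc (length w)) → i ≢ n → term w i ≈ 0#
      -- Cut points run from 0 to the length of `w` inclusive, so `take i w` has length exactly `i`.
      vanish i i∈ i≢n = K.trans (K.*-congʳ (𝐱-homogeneous A (take i w) (λ eq →
        i≢n (trans (sym (ℕₚ.m≤n⇒m⊓n≡m (ℕ.s≤s⁻¹ (∈-upTo⁻ i∈)))) (trans (sym (length-take i w)) eq)))))
        (K.zeroˡ _)

    𝐱-⊙ : 𝐱 A ⊙ 𝐱 B ≋ 𝐱 (A ∣ B)
    𝐱-⊙ w = by (length w ℕ.≟ n ℕ.+ m)
      where
      Claim : Word → Set _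
      Claim w = coeff (𝐱 A ⊙ 𝐱 B) w ≈ coeff (𝐱 (A ∣ B)) w
      by : Dec (length w ≡ n ℕ.+ m) → Claim w
      by (no  w≢) = K.trans (𝐱-⊙-homogeneous w w≢) (K.sym (𝐱-homogeneous (A ∣ B) w w≢))
      by (yes w≡) =
        let (uv , w≡uv)    = toList-surjective w (sym w≡)
            (u , v , uv≡)  = Vec.splitAt n uv
        in subst Claim (sym (trans w≡uv (cong toList uv≡))) (coeff-𝐱-⊙ u v)

  -- Linear independence and spanning

  -- `Möbᵒ.∑≤ n f A` is the sum of `f` over all `E` above `A`. After the sums are exchanged, the
  -- inner one is a lower sum of `ξ`, hence `ζ E C`: the power sum of `E` contains the words with
  -- kernel `C` exactly when `E ≤ᵖ C`.
  ∑-∑≥-ξ : (f : SetPartition n → Carrier) (C : SetPartition n) →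
           sum (allSetPartitions n) (λ A → Möbᵒ.∑≤ n f A * ξ A C) ≈ Möb.∑≤ n f C
  ∑-∑≥-ξ {n} f C = begin
    sum Π (λ A → sum Π (λ E → when (A ≤ᵖ? E) (f E)) * ξ A C)
      ≈⟨ sum-cong Π (λ A → K.trans (*ʳ.sum-hom (ξ A C) Π _) (sum-cong Π (λ E → K.trans
           (*ʳ.when-hom (ξ A C) (A ≤ᵖ? E) (f E))
           (K.sym (*ˡ.when-hom (f E) (A ≤ᵖ? E) (ξ A C)))))) ⟩
    sum Π (λ A → sum Π (λ E → f E * when (A ≤ᵖ? E) (ξ A C)))
      ≈⟨ sum-swap Π Π _ ⟩
    sum Π (λ E → sum Π (λ A → f E * when (A ≤ᵖ? E) (ξ A C)))
      ≈⟨ sum-cong Π (λ E → K.trans (K.sym (*ˡ.sum-hom (f E) Π _)) (K.*-congˡ (∑≤-ξ C E))) ⟩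
    sum Π (λ E → f E * ζ E C)
      ≈⟨ sum-cong Π (λ E → when-1-*ʳ (E ≤ᵖ? C) (f E)) ⟩
    sum Π (λ E → when (E ≤ᵖ? C) (f E)) ∎
    where
    Π = allSetPartitions n

  -- Write `b` as the upper sums of some `f`. The combination then has the lower sums of `f` as
  -- coefficients; as these vanish, so does `f`, and with it `b`.
  ξ-independent : (b : SetPartition n → Carrier) →
    (∀ C → sum (allSetPartitions n) (λ A → b A * ξ A C) ≈ 0#) → ∀ A → b A ≈ 0#
  ξ-independent {n} b b·ξ≈0 A = begin
    b A             ≈⟨ Möbᵒ.∑≤-möbius n b A ⟨
    Möbᵒ.∑≤ n f A   ≈⟨ sum-zero Π (λ E → K.trans (when-cong (A ≤ᵖ? E) (λ _ → f≈0 E)) (when-0 (A ≤ᵖ? E))) ⟩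
    0#              ∎
    where
    Π = allSetPartitions n
    f = Möbᵒ.möbius n b
    when-0 : ∀ {P : Set} (P? : Dec P) → when P? 0# ≈ 0#
    when-0 (yes _) = K.refl
    when-0 (no  _) = K.refl
    f≈0 : ∀ E → f E ≈ 0#
    f≈0 = Möb.∑≤-injective n f (λ _ → 0#) (λ C → begin
      Möb.∑≤ n f C
        ≈⟨ ∑-∑≥-ξ f C ⟨
      sum Π (λ A → Möbᵒ.∑≤ n f A * ξ A C)
        ≈⟨ sum-cong Π (λ A → K.*-congʳ (Möbᵒ.∑≤-möbius n b A)) ⟩
      sum Π (λ A → b A * ξ A C)
        ≈⟨ b·ξ≈0 C ⟩
      0#
        ≈⟨ sum-zero Π (λ A → when-0 (A ≤ᵖ? C)) ⟨
      Möb.∑≤ n (λ _ → 0#) C ∎)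

  private
    module N = FiniteSums (Module.+ᴹ-commutativeMonoid ncsym)
    module CoeffHom (w : Word) = SumHomomorphism
      (Module.+ᴹ-commutativeMonoid ncsym) K.+-commutativeMonoid
      (λ f → coeff f w) (λ _ _ → K.refl) K.refl

    _≟_ : DecidableEquality AnySetPartition
    _≟_ = Σ-≡-dec ℕ._≟_ _≟ᵖ_

  -- Words of length `n` see only the partitions of size `n`, so a combination of mixed sizes can be
  -- treated one size at a time.
  𝐱-independent : (is : List AnySetPartition) → Unique is → (a : AnySetPartition → Carrier) →
    ∑ ncsym is (λ i → a i *ₗ 𝐱 (proj₂ i)) ≋ 0ᴹ →
    ∀ i → i ∈ˡ is → a i ≈ 0#
  𝐱-independent is is-unique a a·𝐱≋0 (n , D) D∈is = begin
    a (n , D) ≈⟨ sum-≡ _≟_ a is-unique D∈is ⟨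
    b D       ≈⟨ ξ-independent b b·ξ≈0 D ⟩
    0#        ∎
    where
    Π = allSetPartitions n
    b : SetPartition n → Carrier
    -- Extension by zero to the partitions of size `n` that are absent from `is`; uniqueness of `is`
    -- ensures that no coefficient is counted twice.
    b A = sum is (λ i → when (i ≟ (n , A)) (a i))

    component : ∀ C i → Dec (proj₁ i ≡ n) →
                sum Π (λ A → when (i ≟ (n , A)) (a i) * ξ A C) ≈
                a i * coeff (𝐱 (proj₂ i)) (canonicalWord C)
    component C i@(_ , A₀) (yes refl) = begin
      sum Π (λ A → when (i ≟ (n , A)) (a i) * ξ A C)
        ≈⟨ sum-single _ (allSetPartitions-unique n) (allSetPartitions-complete A₀)
             (λ A _ A≢A₀ → K.trans
               (K.*-congʳ (when-false (i ≟ (n , A)) (λ { refl → A≢A₀ refl }))) (K.zeroˡ _)) ⟩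
      when (i ≟ (n , A₀)) (a i) * ξ A₀ C
        ≈⟨ K.*-cong (when-true (i ≟ i) refl) (K.reflexive (cong (ξ A₀) (sym (wordKernel-canonical C)))) ⟩
      a i * ξ A₀ (wordKernel (canonicalVec C))
        ≈⟨ K.*-congˡ (coeff-𝐱 A₀ (canonicalVec C)) ⟨
      a i * coeff (𝐱 A₀) (canonicalWord C) ∎
    component C i@(k , A₀) (no k≢n) = K.trans
      (sum-zero Π (λ A → K.trans
        (K.*-congʳ (when-false (i ≟ (n , A)) (k≢n ∘ cong proj₁))) (K.zeroˡ _)))
      (K.sym (K.trans
        (K.*-congˡ (𝐱-homogeneous A₀ _ (λ eq →
          k≢n (trans (sym eq) (length-toList (canonicalVec C))))))
        (K.zeroʳ _)))

    b·ξ≈0 : ∀ C → sum Π (λ A → b A * ξ A C) ≈ 0#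
    b·ξ≈0 C = begin
      sum Π (λ A → b A * ξ A C)
        ≈⟨ sum-cong Π (λ A → *ʳ.sum-hom (ξ A C) is _) ⟩
      sum Π (λ A → sum is (λ i → when (i ≟ (n , A)) (a i) * ξ A C))
        ≈⟨ sum-swap Π is _ ⟩
      sum is (λ i → sum Π (λ A → when (i ≟ (n , A)) (a i) * ξ A C))
        ≈⟨ sum-cong is (λ i → component C i (proj₁ i ℕ.≟ n)) ⟩
      sum is (λ i → a i * coeff (𝐱 (proj₂ i)) (canonicalWord C))
        ≈⟨ CoeffHom.sum-hom (canonicalWord C) is (λ i → a i *ₗ 𝐱 (proj₂ i)) ⟨
      coeff (∑ ncsym is (λ i → a i *ₗ 𝐱 (proj₂ i))) (canonicalWord C)
        ≈⟨ a·𝐱≋0 (canonicalWord C) ⟩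
      0# ∎

  -- The two words have the same kernel, so a bijection of the letters carries one to the other and
  -- symmetry of `f` applies.
  coeff-canonical : (f : NCSym) (v : Vec ℕ n) →
                    coeff f (canonicalWord (wordKernel v)) ≈ coeff f (toList v)
  coeff-canonical f v =
    let (σ , eq) = renameWord v (canonicalVec (wordKernel v))
                     (sym (wordKernel-canonical (wordKernel v)))
    in K.trans (K.reflexive (cong (coeff f) (sym eq))) (symmetric f σ (toList v))

  𝐱-spanning : (f : NCSym) → ∃₂ λ (is : List AnySetPartition) (a : AnySetPartition → Carrier) →
               f ≋ ∑ ncsym is (λ i → a i *ₗ 𝐱 (proj₂ i))
  𝐱-spanning f = is , a , λ w → subst (λ w → coeff f w ≈ coeff combination w)
    (toList∘fromList w) (expansion (Vec.fromList w) (_ ℕ.≤? _))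
    where

    -- The coefficients of `f` in the power sums: their lower sum at `C` must be the coefficient of
    -- `f` at `𝐦 C`.
    c′ : ∀ {d} → SetPartition d → Carrier
    c′ {d} = Möb.möbius d (λ C → coeff f (canonicalWord C))

    is : List AnySetPartition
    is = concatMap (λ d → map (d ,_) (allSetPartitions d)) (upTo (suc (degree f)))

    -- Upper sums turn coefficients in the power sums into coefficients in the `𝐱`, by `∑-∑≥-ξ`.
    a : AnySetPartition → Carrier
    a (d , A) = Möbᵒ.∑≤ d c′ A

    combination : NCSym
    combination = ∑ ncsym is (λ i → a i *ₗ 𝐱 (proj₂ i))

    block : Word → ℕ → Carrier
    block w d = sum (allSetPartitions d) (λ A → a (d , A) * coeff (𝐱 A) w)

    blocks : ∀ w → coeff combination w ≈ sum (upTo (suc (degree f))) (block w)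
    blocks w = K.trans (CoeffHom.sum-hom w is (λ i → a i *ₗ 𝐱 (proj₂ i))) (K.trans
      (sum-concatMap (λ d → map (d ,_) (allSetPartitions d)) (upTo (suc (degree f))) summand)
      (sum-cong (upTo (suc (degree f))) (λ d → sum-map (d ,_) (allSetPartitions d) summand)))
      where
      summand : AnySetPartition → Carrier
      summand i = a i * coeff (𝐱 (proj₂ i)) w

    block-≢ : ∀ {n} (v : Vec ℕ n) d → d ≢ n → block (toList v) d ≈ 0#
    block-≢ v d d≢n = sum-zero (allSetPartitions d) (λ A → K.trans
      (K.*-congˡ (𝐱-homogeneous A _ (λ eq → d≢n (trans (sym eq) (length-toList v)))))
      (K.zeroʳ _))

    expansion : ∀ {n} (v : Vec ℕ n) → Dec (n ℕ.≤ degree f) →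
                coeff f (toList v) ≈ coeff combination (toList v)
    expansion {n} v (yes n≤) = K.sym (begin
      coeff combination (toList v)
        ≈⟨ blocks (toList v) ⟩
      sum (upTo (suc (degree f))) (block (toList v))
        ≈⟨ sum-single _ (upTo⁺ _) (∈-upTo⁺ (ℕ.s≤s n≤)) (λ d _ → block-≢ v d) ⟩
      block (toList v) n
        ≈⟨ sum-cong (allSetPartitions n) (λ A → K.*-congˡ (coeff-𝐱 A v)) ⟩
      sum (allSetPartitions n) (λ A → Möbᵒ.∑≤ n c′ A * ξ A (wordKernel v))
        ≈⟨ ∑-∑≥-ξ c′ (wordKernel v) ⟩
      Möb.∑≤ n c′ (wordKernel v)
        ≈⟨ Möb.∑≤-möbius n _ (wordKernel v) ⟩
      coeff f (canonicalWord (wordKernel v))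
        ≈⟨ coeff-canonical f v ⟩
      coeff f (toList v) ∎)
    -- Beyond the degree bound `f` vanishes, and no block of the combination has size `n`.
    expansion {n} v (no n≰) = K.trans
      (bounded f (toList v) (subst (degree f ℕ.<_) (sym (length-toList v)) (ℕₚ.≰⇒> n≰)))
      (K.sym (K.trans (blocks (toList v)) (K.trans
        (sum-cong-∈ (upTo (suc (degree f))) {g = λ _ → 0#} (λ d d∈ → block-≢ v d
          (λ { refl → n≰ (ℕ.s≤s⁻¹ (∈-upTo⁻ d∈)) })))
        (sum-ε (upTo (suc (degree f)))))))

  𝐱-isBasis : IsBasis ncsym {AnySetPartition} (λ (_ , A) → 𝐱 A)
  𝐱-isBasis = record { independent = 𝐱-independent ; spanning = 𝐱-spanning }

  -- Both sides are the power sum 𝐩_D.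
  ∑𝐦≋∑𝐱 : (D : SetPartition n) →
    N.sum (allSetPartitions n) (λ B → N.when (D ≤ᵖ? B) (𝐦 B)) ≋
    N.sum (allSetPartitions n) (λ A → N.when (A ≤ᵖ? D) (𝐱 A))
  ∑𝐦≋∑𝐱 {n} D w = K.trans (K.trans (CoeffHom.sum-hom w Π (λ B → N.when (D ≤ᵖ? B) (𝐦 B)))
      (sum-cong Π (λ B → CoeffHom.when-hom w (D ≤ᵖ? B) (𝐦 B))))
    (K.trans (by (n ℕ.≟ length w)) (K.sym (K.trans (CoeffHom.sum-hom w Π (λ A → N.when (A ≤ᵖ? D) (𝐱 A)))
      (sum-cong Π (λ A → CoeffHom.when-hom w (A ≤ᵖ? D) (𝐱 A))))))
    where
    Π = allSetPartitions n
    lhs rhs : Word → Carrier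
    lhs w = sum Π (λ B → when (D ≤ᵖ? B) (coeff (𝐦 B) w))
    rhs w = sum Π (λ A → when (A ≤ᵖ? D) (coeff (𝐱 A) w))

    on-vec : (v : Vec ℕ n) → lhs (toList v) ≈ rhs (toList v)
    on-vec v = begin
      sum Π (λ B → when (D ≤ᵖ? B) (coeff (𝐦 B) (toList v)))
        ≈⟨ sum-cong Π (λ B → K.trans (when-cong (D ≤ᵖ? B) (λ _ → coeff-𝐦 B v))
             (when-swap (D ≤ᵖ? B) (B ≟ᵖ wordKernel v))) ⟩
      sum Π (λ B → when (B ≟ᵖ wordKernel v) (ζ D B))
        ≈⟨ sum-≡ _≟ᵖ_ (ζ D) (allSetPartitions-unique n) (allSetPartitions-complete (wordKernel v)) ⟩
      ζ D (wordKernel v)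
        ≈⟨ ∑≤-ξ (wordKernel v) D ⟨
      sum Π (λ A → when (A ≤ᵖ? D) (ξ A (wordKernel v)))
        ≈⟨ sum-cong Π (λ A → when-cong (A ≤ᵖ? D) (λ _ → coeff-𝐱 A v)) ⟨
      sum Π (λ A → when (A ≤ᵖ? D) (coeff (𝐱 A) (toList v))) ∎

    vanish : ∀ {P : Set} (P? : Dec P) {y} → y ≈ 0# → when P? y ≈ 0#
    vanish (yes _) y≈0 = y≈0
    vanish (no  _) _   = K.refl

    by : Dec (n ≡ length w) → lhs w ≈ rhs w
    by (no n≢) = K.trans
      (sum-zero Π (λ B → vanish (D ≤ᵖ? B) (when-false (hasKernel? B w) (n≢ ∘ proj₁))))
      (K.sym (sum-zero Π (λ A → vanish (A ≤ᵖ? D) (𝐱-homogeneous A w (n≢ ∘ sym)))))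
    by (yes n≡) = let (v , w≡) = toList-surjective w n≡ in
      subst (λ w → lhs w ≈ rhs w) (sym w≡) (on-vec v)

-- The internal coproduct.

module Coproduct {c ℓ} (K : Field c ℓ) where
  private module K = Field K
  open K using (0#; 1#)
  open NCSymmetric K
  open Module ncsym using (0ᴹ)
  open FiniteSums K.+-commutativeMonoid using (when)
  open Basis K
  private
    module N = FiniteSums (Module.+ᴹ-commutativeMonoid ncsym)
    module T = FiniteSums (Module.+ᴹ-commutativeMonoid tensorModule)
    module MöbT (n : ℕ) = MöbiusInversion (setPartitionPoset n) (Module.+ᴹ-abelianGroup tensorModule)

  open SetoidReasoning (Module.≈ᴹ-setoid tensorModule)

  ∑-⊗-∑ : {I J : Set} {P : I → Set} {Q : J → Set}
          (P? : ∀ i → Dec (P i)) (Q? : ∀ j → Dec (Q j))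
          (is : List I) (js : List J) (f : I → NCSym) (g : J → NCSym) →
          T.sum (cartesianProduct is js) (λ (i , j) → T.when (P? i ×-dec Q? j) (f i ⊗ g j)) ≈ᵀ
          N.sum is (λ i → N.when (P? i) (f i)) ⊗ N.sum js (λ j → N.when (Q? j) (g j))
  ∑-⊗-∑ P? Q? is js f g = begin
    T.sum (cartesianProduct is js) (λ (i , j) → T.when (P? i ×-dec Q? j) (f i ⊗ g j))
      ≈⟨ T.sum-cartesianProduct is js _ ⟩
    T.sum is (λ i → T.sum js (λ j → T.when (P? i ×-dec Q? j) (f i ⊗ g j)))
      ≈⟨ T.sum-cong is (λ i → T.sum-cong js (λ j → when-⊗-when i j)) ⟨
    T.sum is (λ i → T.sum js (λ j → f′ i ⊗ g′ j))
      ≈⟨ T.sum-cong is (λ i → ⊗ˡ.sum-hom (f′ i) js g′) ⟨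
    T.sum is (λ i → f′ i ⊗ N.sum js g′)
      ≈⟨ ⊗ʳ.sum-hom (N.sum js g′) is f′ ⟨
    N.sum is f′ ⊗ N.sum js g′ ∎
    where
    f′ = λ i → N.when (P? i) (f i)
    g′ = λ j → N.when (Q? j) (g j)
    -- No defining relation of the tensors mentions `0ᴹ`. It is rewritten as `0#` times itself, and
    -- the scalar is moved out of the pure tensor.
    0⊗ : ∀ y → 0ᴹ ⊗ y ≈ᵀ 0ᵀ
    0⊗ y = ≈-trans (⊗-cong (λ w → K.sym (K.zeroˡ 0#)) (λ w → K.refl))
      (≈-trans (⊗-scaleˡ 0# 0ᴹ y) (*-zeroˡ (0ᴹ ⊗ y)))
    ⊗0 : ∀ y → y ⊗ 0ᴹ ≈ᵀ 0ᵀ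
    ⊗0 y = ≈-trans (⊗-cong (λ w → K.refl) (λ w → K.sym (K.zeroˡ 0#)))
      (≈-trans (⊗-scaleʳ 0# y 0ᴹ) (*-zeroˡ (y ⊗ 0ᴹ)))
    module ⊗ʳ (y : NCSym) = SumHomomorphism
      (Module.+ᴹ-commutativeMonoid ncsym) (Module.+ᴹ-commutativeMonoid tensorModule)
      (_⊗ y) (λ x x′ → ⊗-distribʳ x x′ y) (0⊗ y)
    module ⊗ˡ (x : NCSym) = SumHomomorphism
      (Module.+ᴹ-commutativeMonoid ncsym) (Module.+ᴹ-commutativeMonoid tensorModule)
      (x ⊗_) (⊗-distribˡ x) (⊗0 x)
    when-⊗-when : ∀ i j → f′ i ⊗ g′ j ≈ᵀ T.when (P? i ×-dec Q? j) (f i ⊗ g j)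
    when-⊗-when i j = ≈-trans (⊗ʳ.when-hom (g′ j) (P? i) (f i)) (≈-trans
      (T.when-cong (P? i) (λ _ → ⊗ˡ.when-hom (f i) (Q? j) (g j)))
      (T.when-× (P? i) (Q? j)))

  Δ𝐦 : SetPartition n → Tensor
  Δ𝐦 A = T.sum (meetPairs A) (λ (B , C) → 𝐦 B ⊗ 𝐦 C)

  -- `Δ` runs over sizes up to the stored `degree`, which for `𝐱 C` is `n` itself; smaller sizes
  -- drop out by homogeneity.
  Δ-𝐱-expand : (C : SetPartition n) →
               Δ (𝐱 C) ≈ᵀ T.sum (allSetPartitions n) (λ A → ξ C A *ᵀ Δ𝐦 A)
  Δ-𝐱-expand {n} C = ≈-trans
    (T.sum-single block (upTo⁺ (suc n)) (∈-upTo⁺ (ℕₚ.n<1+n n)) (λ d _ d≢n →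
      T.sum-zero (allSetPartitions d) (λ A → ≈-trans
        (*-cong (𝐱-homogeneous C (canonicalWord A) (λ eq →
          d≢n (trans (sym (length-toList (canonicalVec A))) eq))) ≈-refl)
        (*-zeroˡ (Δ𝐦 A)))))
    (T.sum-cong (allSetPartitions n) (λ A → *-cong
      (K.trans (coeff-𝐱 C (canonicalVec A)) (K.reflexive (cong (ξ C) (wordKernel-canonical A))))
      ≈-refl))
    where
    block : ℕ → Tensor
    block d = T.sum (allSetPartitions d) (λ A → coeff (𝐱 C) (canonicalWord A) *ᵀ Δ𝐦 A)

  -- Lower sums turn `ξ` into `ζ`, leaving `Δ𝐦 A` summed over all `A` above `D`. Each pair `B`, `C`
  -- occurs there once, under its meet, so the condition on `A` becomes a condition on `B ∧ C` and
  -- splits into one on each factor.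
  ∑≤-Δ𝐱 : (D : SetPartition n) →
    MöbT.∑≤ n (λ C → T.sum (allSetPartitions n) (λ A → ξ C A *ᵀ Δ𝐦 A)) D ≈ᵀ
    N.sum (allSetPartitions n) (λ B → N.when (D ≤ᵖ? B) (𝐦 B)) ⊗
    N.sum (allSetPartitions n) (λ B → N.when (D ≤ᵖ? B) (𝐦 B))
  ∑≤-Δ𝐱 {n} D = begin
    T.sum Π (λ C → T.when (C ≤ᵖ? D) (T.sum Π (λ A → ξ C A *ᵀ Δ𝐦 A)))
      ≈⟨ T.sum-cong Π (λ C → ≈-trans (T.sum-when (C ≤ᵖ? D) Π (λ A → ξ C A *ᵀ Δ𝐦 A))
           (T.sum-cong Π (λ A → ≈-sym (*ᵀ.when-hom (Δ𝐦 A) (C ≤ᵖ? D) (ξ C A))))) ⟩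
    T.sum Π (λ C → T.sum Π (λ A → when (C ≤ᵖ? D) (ξ C A) *ᵀ Δ𝐦 A))
      ≈⟨ T.sum-swap Π Π (λ C A → when (C ≤ᵖ? D) (ξ C A) *ᵀ Δ𝐦 A) ⟩
    T.sum Π (λ A → T.sum Π (λ C → when (C ≤ᵖ? D) (ξ C A) *ᵀ Δ𝐦 A))
      ≈⟨ T.sum-cong Π (λ A → ≈-trans
           (≈-sym (*ᵀ.sum-hom (Δ𝐦 A) Π (λ C → when (C ≤ᵖ? D) (ξ C A))))
           (*-cong (∑≤-ξ A D) ≈-refl)) ⟩
    T.sum Π (λ A → ζ D A *ᵀ Δ𝐦 A)
      ≈⟨ T.sum-cong Π (λ A → ≈-trans (*ᵀ.when-hom (Δ𝐦 A) (D ≤ᵖ? A) 1#)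
           (T.when-cong (D ≤ᵖ? A) (λ _ → ≈-trans (*-identityˡ (Δ𝐦 A))
             (T.sum-filter (λ (B , C) → B ∧ C ≟ᵖ A) Π² (λ (B , C) → 𝐦 B ⊗ 𝐦 C))))) ⟩
    T.sum Π (λ A → T.when (D ≤ᵖ? A)
      (T.sum Π² (λ (B , C) → T.when (B ∧ C ≟ᵖ A) (𝐦 B ⊗ 𝐦 C))))
      ≈⟨ T.sum-fibre _≟ᵖ_ (allSetPartitions-unique n) allSetPartitions-complete
           (D ≤ᵖ?_) Π² (λ (B , C) → B ∧ C) (λ (B , C) → 𝐦 B ⊗ 𝐦 C) ⟩
    T.sum Π² (λ (B , C) → T.when (D ≤ᵖ? (B ∧ C)) (𝐦 B ⊗ 𝐦 C))
      ≈⟨ T.sum-cong Π² (λ (B , C) →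
           T.when-⇔ (D ≤ᵖ? (B ∧ C)) ((D ≤ᵖ? B) ×-dec (D ≤ᵖ? C)) (≤-∧ D B C)) ⟩
    T.sum Π² (λ (B , C) → T.when ((D ≤ᵖ? B) ×-dec (D ≤ᵖ? C)) (𝐦 B ⊗ 𝐦 C))
      ≈⟨ ∑-⊗-∑ (D ≤ᵖ?_) (D ≤ᵖ?_) Π Π 𝐦 𝐦 ⟩
    N.sum Π (λ B → N.when (D ≤ᵖ? B) (𝐦 B)) ⊗ N.sum Π (λ B → N.when (D ≤ᵖ? B) (𝐦 B)) ∎
    where
    Π  = allSetPartitions n
    Π² = cartesianProduct Π Π
    module *ᵀ (t : Tensor) = SumHomomorphism
      K.+-commutativeMonoid (Module.+ᴹ-commutativeMonoid tensorModule)
      (_*ᵀ t) (*-distribʳ t) (*-zeroˡ t)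

  -- The same regrouping, now by joins: being below `D` splits over `A ∨ B` as being above `D` does
  -- over `B ∧ C`.
  ∑≤-joinPairs : (D : SetPartition n) →
    MöbT.∑≤ n (λ C → T.sum (joinPairs C) (λ (A , B) → 𝐱 A ⊗ 𝐱 B)) D ≈ᵀ
    N.sum (allSetPartitions n) (λ A → N.when (A ≤ᵖ? D) (𝐱 A)) ⊗
    N.sum (allSetPartitions n) (λ A → N.when (A ≤ᵖ? D) (𝐱 A))
  ∑≤-joinPairs {n} D = begin
    T.sum Π (λ C → T.when (C ≤ᵖ? D) (T.sum (joinPairs C) (λ (A , B) → 𝐱 A ⊗ 𝐱 B)))
      ≈⟨ T.sum-cong Π (λ C → T.when-cong (C ≤ᵖ? D) (λ _ →
           T.sum-filter (λ (A , B) → A ∨ B ≟ᵖ C) Π² (λ (A , B) → 𝐱 A ⊗ 𝐱 B))) ⟩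
    T.sum Π (λ C → T.when (C ≤ᵖ? D)
      (T.sum Π² (λ (A , B) → T.when (A ∨ B ≟ᵖ C) (𝐱 A ⊗ 𝐱 B))))
      ≈⟨ T.sum-fibre _≟ᵖ_ (allSetPartitions-unique n) allSetPartitions-complete
           (_≤ᵖ? D) Π² (λ (A , B) → A ∨ B) (λ (A , B) → 𝐱 A ⊗ 𝐱 B) ⟩
    T.sum Π² (λ (A , B) → T.when ((A ∨ B) ≤ᵖ? D) (𝐱 A ⊗ 𝐱 B))
      ≈⟨ T.sum-cong Π² (λ (A , B) →
           T.when-⇔ ((A ∨ B) ≤ᵖ? D) ((A ≤ᵖ? D) ×-dec (B ≤ᵖ? D)) (∨-≤ A B D)) ⟩
    T.sum Π² (λ (A , B) → T.when ((A ≤ᵖ? D) ×-dec (B ≤ᵖ? D)) (𝐱 A ⊗ 𝐱 B))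
      ≈⟨ ∑-⊗-∑ (_≤ᵖ? D) (_≤ᵖ? D) Π Π 𝐱 𝐱 ⟩
    N.sum Π (λ A → N.when (A ≤ᵖ? D) (𝐱 A)) ⊗ N.sum Π (λ A → N.when (A ≤ᵖ? D) (𝐱 A)) ∎
    where
    Π  = allSetPartitions n
    Π² = cartesianProduct Π Π

  -- The lower sums of both sides are the tensor square of one power sum, expanded in the `𝐦` on one
  -- side and in the `𝐱` on the other. Inverting inside the tensor module then gives the identity
  -- for each single `C`.
  Δ-𝐱 : (C : SetPartition n) →
        Δ (𝐱 C) ≈ᵀ ∑ tensorModule (joinPairs C) (λ (A , B) → 𝐱 A ⊗ 𝐱 B)
  Δ-𝐱 {n} C = ≈-trans (Δ-𝐱-expand C) (MöbT.∑≤-injective n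
    (λ C → T.sum (allSetPartitions n) (λ A → ξ C A *ᵀ Δ𝐦 A))
    (λ C → T.sum (joinPairs C) (λ (A , B) → 𝐱 A ⊗ 𝐱 B))
    (λ D → ≈-trans (∑≤-Δ𝐱 D) (≈-trans
      (⊗-cong (∑𝐦≋∑𝐱 D) (∑𝐦≋∑𝐱 D)) (≈-sym (∑≤-joinPairs D))))
    C)

theorem1p3 : ∀ {c ℓ} (K : Field c ℓ) → CharacteristicZero K →
    let open NCSymmetric K in
    ∃ λ (x : ∀ {n} → SetPartition n → NCSym) →
      IsBasis ncsym {AnySetPartition} (λ (_ , A) → x A)
      × (∀ {n} (A : SetPartition n) → IsHomogeneous n (x A))
      × (∀ {n m} (A : SetPartition n) (B : SetPartition m) →
           x A ⊙ x B ≋ x (A ∣ B))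
      × (∀ {n} (C : SetPartition n) →
           Δ (x C) ≈ᵀ ∑ tensorModule (joinPairs C) (λ (A , B) → x A ⊗ x B))
theorem1p3 K _ = 𝐱 , 𝐱-isBasis , 𝐱-homogeneous , 𝐱-⊙ , Δ-𝐱
  where
  open Basis K
  open Coproduct K
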